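{- For all integers $n\geq 0$: (i) $c_{3}(5n+1)\equiv 1 \pmod 2$ if and only if $n=\frac{j(j+1)-2}{10}$ for some integer $j\geq 1$ with $j\equiv 1,3 \pmod 5$; (ii) $c_{3}(5n+2)\equiv 1 \pmod 2$ if and only if $n=\frac{(5j+4)(15j+13)-2}{5}$ for some $j\in\mathbb{Z}$; (iii) $c_{3}(5n+3)\equiv 1 \pmod 2$ if and only if $n=\frac{(5j+2)(5j+3)-6}{10}$ for some integer $j\geq 0$; (iv) $c_{3}(5n+4)\equiv 1 \pmod 2$ if and only if $n=\frac{j(3j+1)-4}{5}$ for some $j\in\mathbb{Z}$ with $j\equiv 1,2 \pmod 5$.
   Context: A partition of $n$ is a finite non-increasing sequence of positive integers (its parts) summing to $n$; the multiplicity of a part is the number of times it occurs. Let $c_{3}(n)$ be the number of partitions of $n$ for which there is a positive integer $j$ such that: the part $1$ appears with multiplicity exactly $j^{2}$ or $j^{2}+1$; odd parts greater than $1$ are distinct; all even parts are distinct; even parts greater than $2j$ are at least $4j+4$ and divisible by $4$; and no even integer in the set $\{2j+2,2j+4,\ldots,4j+2\}$ appears as a part. -}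

module Defs where

open import Data.Nat using (ℕ; zero; suc; _+_; _*_; _∸_; _⊓_; _≤_; _≡ᵇ_; _≤ᵇ_; _%_)
open import Data.Nat.Properties using (_≟_)
open import Data.Bool using (Bool; true; false; _∧_; _∨_; not; if_then_else_)
open import Data.List using (List; []; _∷_; map; concatMap; filter; filterᵇ; length; applyUpTo)
open import Data.Bool.ListAction using (all; any)
open import Relation.Nullary.Decidable using (does)
open import Relation.Binary.PropositionalEquality using (_≡_)

range1 : ℕ → List ℕ
range1 m = applyUpTo suc m

-- partsF f n m : all non-increasing lists of positive integers, each ≤ m,
-- summing to n (fuel f ≥ n suffices since each part is ≥ 1).
partsF : ℕ → ℕ → ℕ → List (List ℕ)
partsF zero    zero    m = [] ∷ []
partsF zero    (suc n) m = []
partsF (suc f) zero    m = [] ∷ []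
partsF (suc f) (suc n) m =
  concatMap (λ k → map (k ∷_) (partsF f (suc n ∸ k) k)) (range1 (suc n ⊓ m))

partitions : ℕ → List (List ℕ)
partitions n = partsF n n n

mult : ℕ → List ℕ → ℕ
mult x p = length (filter (λ y → x ≟ y) p)

isEven : ℕ → Bool
isEven x = x % 2 ≡ᵇ 0

condJ : ℕ → List ℕ → Bool
condJ j p =
  ((mult 1 p ≡ᵇ j * j) ∨ (mult 1 p ≡ᵇ j * j + 1)) ∧ all ok p
  where
  ok : ℕ → Bool
  ok x =
    (if (not (isEven x) ∧ (2 ≤ᵇ x)) then (mult x p ≤ᵇ 1) else true) ∧
    (if isEven x then (mult x p ≤ᵇ 1) else true) ∧
    (if (isEven x ∧ (2 * j + 1 ≤ᵇ x))
       then ((4 * j + 4 ≤ᵇ x) ∧ (x % 4 ≡ᵇ 0)) else true) ∧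
    not (isEven x ∧ (2 * j + 2 ≤ᵇ x) ∧ (x ≤ᵇ 4 * j + 2))

-- there is a positive integer j with condJ j p.  Since j ≤ j² ≤ mult 1 p ≤ n,
-- searching j ∈ {1,…,n} is exhaustive.
isC3 : ℕ → List ℕ → Bool
isC3 n p = any (λ j → condJ j p) (range1 n)

c3 : ℕ → ℕ
c3 n = length (filterᵇ (isC3 n) (partitions n))

{-# OPTIONS --safe #-}

-- Over 𝔽₂ the generating function of c₃ is Σ_{j≥1} q^{j²} (−q;q²)_∞ (q²;q²)_j (−q^{4j+4};q⁴)_∞.
-- Squaring is additive, so (q²;q²)_j (−q^{4j+4};q⁴)_∞ = (q²;q²)²_∞ / (q²;q²)_j, and Euler's identity
-- Σ_{j≥0} q^{j²}/(q²;q²)_j = (−q;q²)_∞ turns the sum into (q²;q²)_∞ + (−q;q²)_∞ (q²;q²)²_∞.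
-- By Euler's pentagonal number theorem and Gauss's triangular number theorem, both obtained from
-- Shanks' finite telescoping identities, this is Σ_{m∈ℤ} q^{m(3m+1)} + Σ_{k≥0} q^{k(k+1)/2}.
-- Modulo 5 the exponents m(3m+1) are 0, 2, 4 and the triangular numbers are 0, 1, 3.

module Submission where

open import Defs
open import Algebra.Bundles using (CommutativeRing; RawRing)
open import Algebra.Structures using (IsCommutativeRing)
import Algebra.Solver.Ring as RingSolver
open import Algebra.Solver.Ring.AlmostCommutativeRing using (fromCommutativeRing; _-Raw-AlmostCommutative⟶_)
open import Data.Bool using (Bool; true; false; _∧_; _∨_; not; if_then_else_; _xor_; T)
open import Data.Bool.ListAction using (all; any)
open import Data.Bool.Properties
  using (∧-comm; ∧-assoc; ∧-distribˡ-xor; ∧-distribʳ-xor; ∧-zeroʳ; ∧-identityʳ;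
         xor-assoc; xor-comm; xor-identityʳ; xor-same; xor-∧-commutativeRing)
open import Data.Empty using (⊥)
open import Data.Integer using (ℤ; +_; -[1+_]; -_) renaming (_+_ to _+ℤ_; _*_ to _*ℤ_)
open import Data.Integer.Base using (_%ℕ_; _/ℕ_)
import Data.Integer.DivMod as ℤ
import Data.Integer.Properties as ℤ
import Data.Integer.Tactic.RingSolver as ℤ
open import Data.List using (List; []; _∷_; _++_; map; concatMap; filterᵇ; length; replicate)
open import Data.List.Properties using (applyUpTo-∷ʳ; concatMap-++; ++-identityʳ; filter-accept; filter-reject)
open import Data.List.Relation.Unary.All as All using (All; []; _∷_)
import Data.List.Relation.Unary.All.Properties as All
open import Data.List.Relation.Unary.AllPairs using (AllPairs; []; _∷_)
import Data.List.Relation.Unary.AllPairs.Properties as AllPairs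
open import Data.Maybe using (Maybe; just; nothing)
open import Data.Nat using (ℕ; zero; suc; _+_; _*_; _∸_; _⊓_; _%_; _≤_; _<_; _≥_; z≤n; s≤s; s≤s⁻¹; _≡ᵇ_; _≤ᵇ_)
open import Data.Nat.DivMod using (_/_; m≡m%n+[m/n]*n; m%n<n; [m+kn]%n≡m%n; m*n%n≡0)
open import Data.Nat.Properties hiding (+-comm; +-assoc; *-comm; *-assoc; +-identityʳ; +-identityˡ)
import Data.Nat.Properties as ℕ
open import Data.Nat.Tactic.RingSolver using (solve-∀)
open import Data.Product using (_×_; _,_; ∃-syntax; proj₁; proj₂)
open import Data.Sum using (_⊎_; inj₁; inj₂)
open import Function using (_∘_)
open import Function.Bundles using (_⇔_; mk⇔; Equivalence)
open import Function.Properties.Equivalence using () renaming (trans to ⇔-trans)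
open import Level using (0ℓ)
open import Relation.Binary.PropositionalEquality
  using (_≡_; _≢_; refl; sym; trans; cong; cong₂; subst; module ≡-Reasoning)
open import Relation.Nullary using (contradiction; proof)
open import Relation.Nullary.Reflects using (Reflects; ofʸ; ofⁿ)

-- No infinite object and no quotient is formed. The coefficient of q^n is read off in 𝔽₂[[q]]/(q^N)
-- with N = n + 1, where each infinite product agrees with a finite one of M ≥ N factors, and
-- 1/(q²;q²)_j, once scaled by (q²;q²)_M, becomes the tail product `D j M`. The only division left
-- is cancellation of a series with constant term 1. The identities of Shanks and Euler become
-- telescoping sums, whose lower boundary term carries the factor 1 + q^0 and so vanishes in
-- characteristic 2. On the combinatorial side, the existential over j has to become a sum before
-- parities can be added. This is possible because j² + 1 < (j + 1)² for j ≥ 1, so the multiplicity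
-- of the part 1 determines j. Finally, equal exponents cancel modulo 2. Inside one series this is
-- excluded because the exponents are distinct. Between the two series it does happen (10 is
-- triangular and equals m(3m+1) at m = -2), but only in the residue class 0 modulo 5, the one class
-- that the two sets of exponents share.

Series : Set
Series = ℕ → Bool

-- Formal power series over 𝔽₂

infixl 6 _⊕_
infixl 7 _⊛_
infix  9 q^_

-- Opaque, so that unification can recover the operands.
opaque

  𝟘 : Series
  𝟘 _ = false

  q^_ : ℕ → Series
  (q^ k) n = k ≡ᵇ n

  _⊕_ : Series → Series → Series
  (f ⊕ g) n = f n xor g n

  _⊛_ : Series → Series → Series
  (f ⊛ g) zero    = f 0 ∧ g 0
  (f ⊛ g) (suc n) = (f 0 ∧ g (suc n)) xor ((λ k → f (suc k)) ⊛ g) n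

shift : Series → Series
shift f n = f (suc n)

xor-interchange : ∀ a b c d → (a xor b) xor (c xor d) ≡ (a xor c) xor (b xor d)
xor-interchange a b c d = begin
  (a xor b) xor (c xor d) ≡⟨ xor-assoc a b _ ⟩
  a xor (b xor (c xor d)) ≡⟨ cong (a xor_) (xor-assoc b c d) ⟨
  a xor ((b xor c) xor d) ≡⟨ cong (λ x → a xor (x xor d)) (xor-comm b c) ⟩
  a xor ((c xor b) xor d) ≡⟨ cong (a xor_) (xor-assoc c b d) ⟩
  a xor (c xor (b xor d)) ≡⟨ xor-assoc a c _ ⟨
  (a xor c) xor (b xor d) ∎
  where open ≡-Reasoning

xor-swap : ∀ a b c → a xor (b xor c) ≡ b xor (a xor c)
xor-swap a b c = trans (sym (xor-assoc a b c)) (trans (cong (_xor c) (xor-comm a b)) (xor-assoc b a c))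

opaque
  unfolding 𝟘 q^_ _⊕_ _⊛_

  -- Mirror image of the defining recursion: it peels the second factor instead of the first.
  -- Together the two give commutativity by induction.
  ⊛-suc : ∀ f g n → (f ⊛ g) (suc n) ≡ (f (suc n) ∧ g 0) xor (f ⊛ shift g) n
  ⊛-suc f g zero    = xor-comm (f 0 ∧ g 1) (f 1 ∧ g 0)
  ⊛-suc f g (suc n) = trans (cong (f 0 ∧ g (suc (suc n)) xor_) (⊛-suc (shift f) g n))
    (xor-swap (f 0 ∧ g (suc (suc n))) (f (suc (suc n)) ∧ g 0) _)

  ⊛-comm : ∀ f g n → (f ⊛ g) n ≡ (g ⊛ f) n
  ⊛-comm f g zero    = ∧-comm (f 0) (g 0)
  ⊛-comm f g (suc n) = trans (cong₂ _xor_ (∧-comm (f 0) (g (suc n))) (⊛-comm (shift f) g n)) (sym (⊛-suc g f n))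

  ⊛-distribʳ : ∀ h f g n → ((f ⊕ g) ⊛ h) n ≡ (f ⊛ h) n xor (g ⊛ h) n
  ⊛-distribʳ h f g zero    = ∧-distribʳ-xor (h 0) (f 0) (g 0)
  ⊛-distribʳ h f g (suc n) = trans
    (cong₂ _xor_ (∧-distribʳ-xor (h (suc n)) (f 0) (g 0)) (⊛-distribʳ h (shift f) (shift g) n))
    (xor-interchange (f 0 ∧ h (suc n)) (g 0 ∧ h (suc n)) _ _)

  ⊛-scale : ∀ c f g n → ((λ k → c ∧ f k) ⊛ g) n ≡ c ∧ (f ⊛ g) n
  ⊛-scale c f g zero    = ∧-assoc c (f 0) (g 0)
  ⊛-scale c f g (suc n) = trans (cong₂ _xor_ (∧-assoc c (f 0) (g (suc n))) (⊛-scale c (shift f) g n))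
    (sym (∧-distribˡ-xor c (f 0 ∧ g (suc n)) _))

  ⊛-assoc : ∀ f g h n → ((f ⊛ g) ⊛ h) n ≡ (f ⊛ (g ⊛ h)) n
  ⊛-assoc f g h zero    = ∧-assoc (f 0) (g 0) (h 0)
  ⊛-assoc f g h (suc n) = begin
    -- By definition `shift (f ⊛ g)` is `f 0` times `shift g`, plus `shift f ⊛ g`.
    ((f 0 ∧ g 0) ∧ h (suc n)) xor (shift (f ⊛ g) ⊛ h) n
      ≡⟨ cong₂ _xor_ (∧-assoc (f 0) (g 0) (h (suc n)))
           (⊛-distribʳ h (λ k → f 0 ∧ shift g k) (shift f ⊛ g) n) ⟩
    (f 0 ∧ (g 0 ∧ h (suc n))) xor (((λ k → f 0 ∧ shift g k) ⊛ h) n xor ((shift f ⊛ g) ⊛ h) n)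
      ≡⟨ xor-assoc (f 0 ∧ (g 0 ∧ h (suc n))) _ _ ⟨
    ((f 0 ∧ (g 0 ∧ h (suc n))) xor ((λ k → f 0 ∧ shift g k) ⊛ h) n) xor ((shift f ⊛ g) ⊛ h) n
      ≡⟨ cong₂ _xor_ (trans (cong (f 0 ∧ (g 0 ∧ h (suc n)) xor_) (⊛-scale (f 0) (shift g) h n))
                        (sym (∧-distribˡ-xor (f 0) (g 0 ∧ h (suc n)) _)))
           (⊛-assoc (shift f) g h n) ⟩
    (f ⊛ (g ⊛ h)) (suc n) ∎
    where open ≡-Reasoning

  ⊛-zeroˡ : ∀ f n → (𝟘 ⊛ f) n ≡ false
  ⊛-zeroˡ f zero    = refl
  ⊛-zeroˡ f (suc n) = ⊛-zeroˡ f n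

  ⊛-identityˡ : ∀ f n → (q^ 0 ⊛ f) n ≡ f n
  ⊛-identityˡ f zero    = refl
  ⊛-identityˡ f (suc n) = trans (cong (f (suc n) xor_) (⊛-zeroˡ f n)) (xor-identityʳ _)

  q^-⊛-≥ : ∀ k f n → (q^ k ⊛ f) (k + n) ≡ f n
  q^-⊛-≥ zero    f n = ⊛-identityˡ f n
  q^-⊛-≥ (suc k) f n = q^-⊛-≥ k f n

  q^-⊛-< : ∀ {k n} f → n < k → (q^ k ⊛ f) n ≡ false
  q^-⊛-< {suc k} {zero}  f _         = refl
  q^-⊛-< {suc k} {suc n} f (s≤s n<k) = q^-⊛-< {k} {n} f n<k

  q^-+′ : ∀ a b n → (q^ (a + b)) n ≡ (q^ a ⊛ q^ b) n
  q^-+′ zero    b n       = sym (⊛-identityˡ (q^ b) n)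
  q^-+′ (suc a) b zero    = refl
  q^-+′ (suc a) b (suc n) = q^-+′ a b n

  ⊛-cong′ : ∀ {f f′ g g′} n → (∀ i → i ≤ n → f i ≡ f′ i) → (∀ i → i ≤ n → g i ≡ g′ i) →
            (f ⊛ g) n ≡ (f′ ⊛ g′) n
  ⊛-cong′ zero    p r = cong₂ _∧_ (p 0 z≤n) (r 0 z≤n)
  ⊛-cong′ (suc n) p r = cong₂ _xor_ (cong₂ _∧_ (p 0 z≤n) (r (suc n) ≤-refl))
    (⊛-cong′ n (λ i i≤n → p (suc i) (s≤s i≤n)) (λ i i≤n → r i (m≤n⇒m≤1+n i≤n)))

  -- Substitute for dividing by a unit. Since `g 0` is 1, the lowest coefficient of f is 0; the
  -- first term of the product recursion then drops out, and `shift f` satisfies the same hypothesis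
  -- with N lowered by one.
  ⊛-cancel-zero : ∀ {N} f g → g 0 ≡ true → (∀ i → i < N → (f ⊛ g) i ≡ false) → ∀ i → i < N → f i ≡ false
  ⊛-cancel-zero {suc N} f g g₀ fg≈0 = go
    where
    f₀ : f 0 ≡ false
    f₀ = trans (sym (trans (cong (f 0 ∧_) g₀) (∧-identityʳ _))) (fg≈0 0 (s≤s z≤n))
    go : ∀ i → i < suc N → f i ≡ false
    go zero    _         = f₀
    go (suc i) (s≤s i<N) = ⊛-cancel-zero (shift f) g g₀
      (λ k k<N → trans (cong (λ b → (b ∧ g (suc k)) xor (shift f ⊛ g) k) (sym f₀)) (fg≈0 (suc k) (s≤s k<N))) i i<N

∑ : (ℕ → Series) → ℕ → Series
∑ f zero    = 𝟘
∑ f (suc n) = ∑ f n ⊕ f n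

∏ : (ℕ → Series) → ℕ → Series
∏ f zero    = q^ 0
∏ f (suc n) = ∏ f n ⊛ f n

-- The Boolean switches the factor 1 + q^k on or off. Products over different sets of exponents can
-- then run over the same index range and be compared factor by factor.
fac : Bool → ℕ → Series
fac b k = q^ 0 ⊕ (if b then q^ k else 𝟘)

-- For s ≤ n, D s n is (q²;q²)_n / (q²;q²)_s, and O n is (−q;q²)_n.
D : ℕ → ℕ → Series
D s n = ∏ (λ i → fac (s ≤ᵇ i) (2 * suc i)) n

O : ℕ → Series
O n = ∏ (λ i → fac true (2 * i + 1)) n

tri : ℕ → ℕ
tri zero    = 0
tri (suc s) = tri s + suc s

-- Which part sizes are admissible for a given j

≤⇒≤ᵇ≡ : ∀ {m n} → m ≤ n → (m ≤ᵇ n) ≡ true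
≤⇒≤ᵇ≡ {m} {n} m≤n with m ≤ᵇ n | ≤⇒≤ᵇ m≤n
... | true | _ = refl

>⇒≤ᵇ≡ : ∀ {m n} → n < m → (m ≤ᵇ n) ≡ false
>⇒≤ᵇ≡ {m} {n} n<m with m ≤ᵇ n in eq
... | false = refl
... | true  = contradiction (≤ᵇ⇒≤ m n (subst T (sym eq) _)) (<⇒≱ n<m)

-- The condition that condJ j places on a part x occurring c times.
okMult : ℕ → ℕ → ℕ → Bool
okMult j c x =
  (if (not (isEven x) ∧ (2 ≤ᵇ x)) then (c ≤ᵇ 1) else true) ∧
  (if isEven x then (c ≤ᵇ 1) else true) ∧
  (if (isEven x ∧ (2 * j + 1 ≤ᵇ x))
     then ((4 * j + 4 ≤ᵇ x) ∧ (x % 4 ≡ᵇ 0)) else true) ∧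
  not (isEven x ∧ (2 * j + 2 ≤ᵇ x) ∧ (x ≤ᵇ 4 * j + 2))

isEven-even : ∀ k → isEven (2 * k) ≡ true
isEven-even k = cong (_≡ᵇ 0) (trans (cong (_% 2) (ℕ.*-comm 2 k)) (m*n%n≡0 k 2))

isEven-odd : ∀ k → isEven (suc (2 * k)) ≡ false
isEven-odd k = cong (_≡ᵇ 0) (trans (cong (λ x → suc x % 2) (ℕ.*-comm 2 k)) ([m+kn]%n≡m%n 1 k 2))

ok-odd : ∀ j k → okMult j 1 (suc (2 * k)) ≡ true
ok-odd j k rewrite isEven-odd k with 2 ≤ᵇ suc (2 * k)
... | true  = refl
... | false = refl

2+2k : ∀ k → 2 * k + 2 ≡ 2 * suc k
2+2k = solve-∀

4+4k : ∀ k → 4 * k + 4 ≡ 4 * suc k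
4+4k = solve-∀

ok-even-small : ∀ {j k} → k < j → okMult j 1 (2 * suc k) ≡ true
ok-even-small {j} {k} k<j
  rewrite isEven-even (suc k)
        | >⇒≤ᵇ≡ {2 * j + 1} {2 * suc k} (≤-<-trans (*-monoʳ-≤ 2 k<j) (m<m+n (2 * j) (s≤s z≤n)))
        | >⇒≤ᵇ≡ {2 * j + 2} {2 * suc k} (≤-<-trans (*-monoʳ-≤ 2 k<j) (m<m+n (2 * j) (s≤s z≤n)))
  = refl

2j+2≤ : ∀ {j k} → j ≤ k → 2 * j + 2 ≤ 2 * suc k
2j+2≤ {j} j≤k = ≤-trans (≤-reflexive (2+2k j)) (*-monoʳ-≤ 2 (s≤s j≤k))

ok-even-large : ∀ {j k} → j ≤ k →
  okMult j 1 (2 * suc k) ≡ ((4 * j + 4 ≤ᵇ 2 * suc k) ∧ (2 * suc k % 4 ≡ᵇ 0)) ∧ not (2 * suc k ≤ᵇ 4 * j + 2)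
ok-even-large {j} {k} j≤k
  rewrite isEven-even (suc k)
        | ≤⇒≤ᵇ≡ {2 * j + 1} {2 * suc k} (≤-trans (+-monoʳ-≤ (2 * j) (s≤s z≤n)) (2j+2≤ j≤k))
        | ≤⇒≤ᵇ≡ {2 * j + 2} {2 * suc k} (2j+2≤ j≤k)
  = refl

ok-2mod4 : ∀ j i → okMult j 1 (2 * suc (2 * i)) ≡ (suc (2 * i) ≤ᵇ j)
ok-2mod4 j i with <-≤-connex (2 * i) j
... | inj₁ k<j = trans (ok-even-small k<j) (sym (≤⇒≤ᵇ≡ k<j))
... | inj₂ j≤k = trans (ok-even-large j≤k)
  (trans (cong (λ r → ((4 * j + 4 ≤ᵇ 2 * suc (2 * i)) ∧ (r ≡ᵇ 0)) ∧ not (2 * suc (2 * i) ≤ᵇ 4 * j + 2)) r≡2)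
  (trans (cong (_∧ not (2 * suc (2 * i) ≤ᵇ 4 * j + 2)) (∧-zeroʳ (4 * j + 4 ≤ᵇ 2 * suc (2 * i))))
         (sym (>⇒≤ᵇ≡ (s≤s j≤k)))))
  where
  eq : ∀ i → 2 * suc (2 * i) ≡ 2 + i * 4
  eq = solve-∀
  r≡2 : 2 * suc (2 * i) % 4 ≡ 2
  r≡2 = trans (cong (_% 4) (eq i)) ([m+kn]%n≡m%n 2 i 4)

4+4i : ∀ i → 4 * suc i ≡ 2 * suc (2 * i + 1)
4+4i = solve-∀

4+4i%4 : ∀ i → 2 * suc (2 * i + 1) % 4 ≡ 0
4+4i%4 i = trans (cong (_% 4) (trans (sym (4+4i i)) (ℕ.*-comm 4 (suc i)))) (m*n%n≡0 (suc i) 4)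

4j+4≤ : ∀ {j i} → j ≤ i → 4 * j + 4 ≤ 2 * suc (2 * i + 1)
4j+4≤ {j} {i} j≤i = ≤-trans (≤-reflexive (4+4k j)) (≤-trans (*-monoʳ-≤ 4 (s≤s j≤i)) (≤-reflexive (4+4i i)))

-- The factor of the part 1 is 1 + q: its multiplicity in excess of j² is 0 or 1.
H : ℕ → ℕ → Series
H j m = ∏ (λ i → fac (okMult j 1 (suc i)) (suc i)) m

-- The values of m(3m+1) at m = -(s+1) and at m = s, in the form of twice a square plus a triangular
-- number, as Shanks' identity produces them.
negExp posExp : ℕ → ℕ
negExp s = 2 * (suc s * suc s + tri s)
posExp s = 2 * (s * s + tri s)

-- The ring 𝔽₂[[q]]/(q^N)

module Truncated (N : ℕ) where

  infix 4 _≈_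
  record _≈_ (f g : Series) : Set where
    constructor agree
    field coeff : ∀ i → i < N → f i ≡ g i
  open _≈_ public

  ptwise : ∀ {f g} → (∀ i → f i ≡ g i) → f ≈ g
  ptwise p = agree λ i _ → p i

  ≈-refl : ∀ {f} → f ≈ f
  ≈-refl = ptwise λ _ → refl

  ⊛-cong : ∀ {f f′ g g′} → f ≈ f′ → g ≈ g′ → f ⊛ g ≈ f′ ⊛ g′
  ⊛-cong p r = agree λ n n<N → ⊛-cong′ n (λ i i≤n → coeff p i (≤-<-trans i≤n n<N)) (λ i i≤n → coeff r i (≤-<-trans i≤n n<N))

  opaque
    unfolding 𝟘 _⊕_

    isCommutativeRing : IsCommutativeRing _≈_ _⊕_ _⊛_ (λ f → f) 𝟘 (q^ 0)
    isCommutativeRing = record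
      { isRing = record
        { +-isAbelianGroup = record
          { isGroup = record
            { isMonoid = record
              { isSemigroup = record
                { isMagma = record
                  { isEquivalence = record
                    { refl  = ≈-refl
                    ; sym   = λ p → agree λ i i<N → sym (coeff p i i<N)
                    ; trans = λ p r → agree λ i i<N → trans (coeff p i i<N) (coeff r i i<N)
                    }
                  ; ∙-cong = λ p r → agree λ i i<N → cong₂ _xor_ (coeff p i i<N) (coeff r i i<N)
                  }
                ; assoc = λ f g h → ptwise λ i → xor-assoc (f i) (g i) (h i)
                }
              ; identity = (λ f → ≈-refl) , (λ f → ptwise λ i → xor-identityʳ (f i))
              }
            ; inverse = (λ f → ptwise λ i → xor-same (f i)) , (λ f → ptwise λ i → xor-same (f i))
            ; ⁻¹-cong = λ p → p
            }
          ; comm = λ f g → ptwise λ i → xor-comm (f i) (g i)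
          }
        ; *-cong = ⊛-cong
        ; *-assoc = λ f g h → ptwise (⊛-assoc f g h)
        ; *-identity = (λ f → ptwise (⊛-identityˡ f))
                     , (λ f → ptwise λ n → trans (⊛-comm f (q^ 0) n) (⊛-identityˡ f n))
        ; distrib = (λ h f g → ptwise λ n → trans (⊛-comm h (f ⊕ g) n)
                        (trans (⊛-distribʳ h f g n) (cong₂ _xor_ (⊛-comm f h n) (⊛-comm g h n))))
                  , (λ h f g → ptwise (⊛-distribʳ h f g))
        }
      ; *-comm = λ f g → ptwise (⊛-comm f g)
      }

  ring : CommutativeRing 0ℓ 0ℓ
  ring = record
    { Carrier = Series ; _≈_ = _≈_ ; _+_ = _⊕_ ; _*_ = _⊛_ ; -_ = λ f → f ; 0# = 𝟘 ; 1# = q^ 0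
    ; isCommutativeRing = isCommutativeRing
    }

  open CommutativeRing ring public
    using (setoid; reflexive; +-comm; +-assoc; *-comm; *-assoc; +-cong; +-congˡ; +-congʳ; *-congˡ; *-congʳ;
           +-identityˡ; +-identityʳ)
    renaming (sym to ≈-sym; trans to ≈-trans)

  private
    𝔽₂ : RawRing 0ℓ 0ℓ
    𝔽₂ = CommutativeRing.rawRing xor-∧-commutativeRing

    embed : 𝔽₂ -Raw-AlmostCommutative⟶ fromCommutativeRing ring
    embed = record
      { ⟦_⟧    = λ b → if b then q^ 0 else 𝟘
      ; +-homo = λ { false b → ≈-sym (+-identityˡ _) ; true false → ≈-sym (+-identityʳ _)
                 ; true true → ≈-sym (CommutativeRing.-‿inverseʳ ring _) }
      ; *-homo = λ { false b → ≈-sym (CommutativeRing.zeroˡ ring _) ; true b → ≈-sym (CommutativeRing.*-identityˡ ring _) }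
      ; -‿homo = λ _ → ≈-refl
      ; 0-homo = ≈-refl
      ; 1-homo = ≈-refl
      }

    _≟?_ : ∀ a b → Maybe ((if a then q^ 0 else 𝟘) ≈ (if b then q^ 0 else 𝟘))
    false ≟? false = just ≈-refl
    true  ≟? true  = just ≈-refl
    _     ≟? _     = nothing

  -- Coefficients in 𝔽₂, so that the normaliser knows the characteristic is 2.
  module S = RingSolver 𝔽₂ (fromCommutativeRing ring) embed _≟?_
  open S using (solve; _:+_; _:*_; _:=_; con)

  module ≈R where
    open import Relation.Binary.Reasoning.Setoid setoid public

  q^-+ : ∀ {e} a b → e ≡ a + b → q^ e ≈ q^ a ⊛ q^ b
  q^-+ a b refl = ptwise (q^-+′ a b)

  opaque
    unfolding 𝟘 q^_

    q^-vanish : ∀ {k} → N ≤ k → q^ k ≈ 𝟘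
    q^-vanish {k} N≤k = agree λ i i<N → go k i (<-≤-trans i<N N≤k)
      where
      go : ∀ k i → i < k → (k ≡ᵇ i) ≡ false
      go (suc k) zero    _         = refl
      go (suc k) (suc i) (s≤s i<k) = go k i i<k

  ⊛-vanish : ∀ f {g} → g ≈ 𝟘 → f ⊛ g ≈ 𝟘
  ⊛-vanish f g≈0 = ≈-trans (*-congˡ {f} g≈0) (solve 1 (λ f → f :* con false := con false) ≈-refl f)

  fac-false : ∀ k → fac false k ≈ q^ 0
  fac-false k = solve 0 (con true :+ con false := con true) ≈-refl

  fac-vanish : ∀ b {k} → N ≤ k → fac b k ≈ q^ 0
  fac-vanish false {k} _   = fac-false k
  fac-vanish true      N≤k = ≈-trans (+-congˡ {q^ 0} (q^-vanish N≤k)) (fac-false 0)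

  -- Finite sums and products

  ∑-cong : ∀ {f g} n → (∀ i → i < n → f i ≈ g i) → ∑ f n ≈ ∑ g n
  ∑-cong zero    p = ≈-refl
  ∑-cong (suc n) p = +-cong (∑-cong n λ i i<n → p i (m<n⇒m<1+n i<n)) (p n ≤-refl)

  ∑-⊛ : ∀ c f n → ∑ (λ i → c ⊛ f i) n ≈ c ⊛ ∑ f n
  ∑-⊛ c f zero    = solve 1 (λ c → con false := c :* con false) ≈-refl c
  ∑-⊛ c f (suc n) = ≈-trans (+-congʳ (∑-⊛ c f n))
    (solve 3 (λ c a b → c :* a :+ c :* b := c :* (a :+ b)) ≈-refl c (∑ f n) (f n))

  ∑-vanish : ∀ {f} n → (∀ i → i < n → f i ≈ 𝟘) → ∑ f n ≈ 𝟘
  ∑-vanish zero    p = ≈-refl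
  ∑-vanish (suc n) p = ≈-trans (+-cong (∑-vanish n λ i i<n → p i (m<n⇒m<1+n i<n)) (p n ≤-refl))
    (+-identityˡ 𝟘)

  ∑-head : ∀ f n → ∑ f (suc n) ≈ f 0 ⊕ ∑ (λ i → f (suc i)) n
  ∑-head f zero    = +-comm 𝟘 (f 0)
  ∑-head f (suc n) = ≈-trans (+-congʳ (∑-head f n)) (+-assoc (f 0) _ _)

  -- As -1 = 1, `f i ⊕ g i` is a termwise difference, and V is a certificate that it telescopes.
  -- Both Shanks identities and Euler's functional equation have this shape.
  ∑-telescope : ∀ {f g : ℕ → Series} (V : ℕ → Series) n → (∀ i → i < n → f i ⊕ g i ≈ V i ⊕ V (suc i)) →
                ∑ f n ⊕ ∑ g n ≈ V 0 ⊕ V n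
  ∑-telescope         V zero    p = solve 1 (λ v → con false :+ con false := v :+ v) ≈-refl (V 0)
  ∑-telescope {f} {g} V (suc n) p = begin
    (∑ f n ⊕ f n) ⊕ (∑ g n ⊕ g n)
      ≈⟨ solve 4 (λ a b c d → (a :+ b) :+ (c :+ d) := (a :+ c) :+ (b :+ d)) ≈-refl (∑ f n) (f n) (∑ g n) (g n) ⟩
    (∑ f n ⊕ ∑ g n) ⊕ (f n ⊕ g n)
      ≈⟨ +-cong (∑-telescope V n λ i i<n → p i (m<n⇒m<1+n i<n)) (p n ≤-refl) ⟩
    (V 0 ⊕ V n) ⊕ (V n ⊕ V (suc n))
      ≈⟨ solve 3 (λ a b c → (a :+ b) :+ (b :+ c) := a :+ c) ≈-refl (V 0) (V n) (V (suc n)) ⟩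
    V 0 ⊕ V (suc n) ∎
    where open ≈R

  ∏-cong : ∀ {f g} n → (∀ i → i < n → f i ≈ g i) → ∏ f n ≈ ∏ g n
  ∏-cong zero    p = ≈-refl
  ∏-cong (suc n) p = ⊛-cong (∏-cong n λ i i<n → p i (m<n⇒m<1+n i<n)) (p n ≤-refl)

  ∏-⊛ : ∀ f g n → ∏ (λ i → f i ⊛ g i) n ≈ ∏ f n ⊛ ∏ g n
  ∏-⊛ f g zero    = solve 0 (con true := con true :* con true) ≈-refl
  ∏-⊛ f g (suc n) = ≈-trans (*-congʳ (∏-⊛ f g n))
    (solve 4 (λ a b c d → (a :* b) :* (c :* d) := (a :* c) :* (b :* d)) ≈-refl (∏ f n) (∏ g n) (f n) (g n))

  ∏-stable : ∀ f {m} k → (∀ i → m ≤ i → f i ≈ q^ 0) → ∏ f (k + m) ≈ ∏ f m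
  ∏-stable f     zero    p = ≈-refl
  ∏-stable f {m} (suc k) p = ≈-trans (⊛-cong (∏-stable f k p) (p (k + m) (m≤n+m m k)))
    (solve 1 (λ a → a :* con true := a) ≈-refl (∏ f m))

  ∏-parity : ∀ f n → ∏ f (2 * n) ≈ ∏ (λ i → f (2 * i)) n ⊛ ∏ (λ i → f (2 * i + 1)) n
  ∏-parity f zero    = solve 0 (con true := con true :* con true) ≈-refl
  ∏-parity f (suc n) = begin
    ∏ f (2 * suc n)
      ≡⟨ cong (∏ f) (eq n) ⟩
    ∏ f (2 * n) ⊛ f (2 * n) ⊛ f (suc (2 * n))
      ≡⟨ cong (λ k → ∏ f (2 * n) ⊛ f (2 * n) ⊛ f k) (ℕ.+-comm 1 (2 * n)) ⟩
    ∏ f (2 * n) ⊛ f (2 * n) ⊛ f (2 * n + 1)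
      ≈⟨ *-congʳ (*-congʳ (∏-parity f n)) ⟩
    (∏ (λ i → f (2 * i)) n ⊛ ∏ (λ i → f (2 * i + 1)) n) ⊛ f (2 * n) ⊛ f (2 * n + 1)
      ≈⟨ solve 4 (λ a b c d → a :* b :* c :* d := (a :* c) :* (b :* d)) ≈-refl
           (∏ (λ i → f (2 * i)) n) (∏ (λ i → f (2 * i + 1)) n) (f (2 * n)) (f (2 * n + 1)) ⟩
    ∏ (λ i → f (2 * i)) (suc n) ⊛ ∏ (λ i → f (2 * i + 1)) (suc n) ∎
    where
    open ≈R
    eq : ∀ n → 2 * suc n ≡ suc (suc (2 * n))
    eq = solve-∀

  D-step : ∀ {s n} → s ≤ n → D s (suc n) ≈ D s n ⊛ fac true (2 * suc n)
  D-step {s} {n} s≤n = reflexive (cong (λ b → D s n ⊛ fac b (2 * suc n)) (≤⇒≤ᵇ≡ s≤n))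

  D-empty : ∀ {s} n → n ≤ s → D s n ≈ q^ 0
  D-empty {s} zero    _   = ≈-refl
  D-empty {s} (suc n) n<s = ≈-trans
    (⊛-cong (D-empty n (<⇒≤ n<s))
      (≈-trans (reflexive (cong (λ b → fac b (2 * suc n)) (>⇒≤ᵇ≡ n<s))) (fac-false (2 * suc n))))
    (solve 0 (con true :* con true := con true) ≈-refl)

  -- `D-step` exposes the top factor, but passing from s to s + 1 inside a telescoping sum needs the
  -- bottom one. This is the division-free form of (q²;q²)_{s+1} = (q²;q²)_s (1 + q^{2s+2}) in a
  -- denominator.
  D-peel : ∀ {s n} → s < n → D s n ≈ fac true (2 * suc s) ⊛ D (suc s) n
  D-peel {s} {suc n} (s≤s s≤n) with m≤n⇒m<n∨m≡n s≤n
  ... | inj₁ s<n = begin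
    D s (suc n)                                          ≈⟨ D-step s≤n ⟩
    D s n ⊛ fac true (2 * suc n)                          ≈⟨ *-congʳ (D-peel s<n) ⟩
    fac true (2 * suc s) ⊛ D (suc s) n ⊛ fac true (2 * suc n) ≈⟨ *-assoc (fac true (2 * suc s)) _ _ ⟩
    fac true (2 * suc s) ⊛ (D (suc s) n ⊛ fac true (2 * suc n)) ≈⟨ *-congˡ (D-step s<n) ⟨
    fac true (2 * suc s) ⊛ D (suc s) (suc n)             ∎
    where open ≈R
  ... | inj₂ refl = begin
    D s (suc s)                          ≈⟨ D-step ≤-refl ⟩
    D s s ⊛ fac true (2 * suc s)         ≈⟨ *-congʳ (D-empty s ≤-refl) ⟩
    q^ 0 ⊛ fac true (2 * suc s)          ≈⟨ *-comm (q^ 0) _ ⟩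
    fac true (2 * suc s) ⊛ q^ 0          ≈⟨ *-congˡ (D-empty (suc s) ≤-refl) ⟨
    fac true (2 * suc s) ⊛ D (suc s) (suc s) ∎
    where open ≈R

  -- Shanks: Σ_{s≤n} P n s is the n-th partial sum of the pentagonal series, and only P n 0 = (q²;q²)_n
  -- is nonzero modulo q^n.
  module Pentagonal where

    -- P is Shanks' summand with q replaced by q² and its sign (-1)^s dropped modulo 2. V is the
    -- telescoping certificate; its factor 1 + q^{2s} makes it vanish at s = 0.
    P V : ℕ → ℕ → Series
    P n s = D s n ⊛ q^ (2 * (s * n + tri s))
    V n s = P n s ⊛ fac true (2 * s)

    pent : ℕ → Series
    pent n = q^ 0 ⊕ ∑ (λ s → q^ (2 * (suc s * suc s + tri s)) ⊕ q^ (2 * (suc s * suc s + tri (suc s)))) n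

    step : ∀ {n s} → s ≤ n → P (suc n) s ⊕ P n s ≈ V n s ⊕ P n s ⊛ q^ (2 * (s + suc n))
    step {n} {s} s≤n = begin
      D s (suc n) ⊛ q^ (2 * (s * suc n + tri s)) ⊕ P n s
        ≈⟨ +-congʳ (⊛-cong (D-step s≤n) (q^-+ _ _ (eq n s (tri s)))) ⟩
      (D s n ⊛ fac true (2 * suc n)) ⊛ (q^ (2 * (s * n + tri s)) ⊛ q^ (2 * s)) ⊕ P n s
        ≈⟨ solve 4 (λ d e x y → (d :* (con true :+ y)) :* (e :* x) :+ d :* e
                             := d :* e :* (con true :+ x) :+ d :* e :* (x :* y)) ≈-refl
             (D s n) (q^ (2 * (s * n + tri s))) (q^ (2 * s)) (q^ (2 * suc n)) ⟩
      V n s ⊕ P n s ⊛ (q^ (2 * s) ⊛ q^ (2 * suc n))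
        ≈⟨ +-congˡ (*-congˡ (q^-+ _ _ (*-distribˡ-+ 2 s (suc n)))) ⟨
      V n s ⊕ P n s ⊛ q^ (2 * (s + suc n)) ∎
      where
      open ≈R
      eq : ∀ n s t → 2 * (s * suc n + t) ≡ 2 * (s * n + t) + 2 * s
      eq = solve-∀

    -- The bottom factor 1 + q^{2s+2} of `D s n` turns into the extra factor of `V n (suc s)`. For s
    -- = n the product is empty and has no such factor; the leftover is then a bare power of q,
    -- treated in `diagonal`.
    carry : ∀ {n s} → s < n → P n s ⊛ q^ (2 * (s + suc n)) ≈ V n (suc s)
    carry {n} {s} s<n = begin
      D s n ⊛ q^ (2 * (s * n + tri s)) ⊛ q^ (2 * (s + suc n))
        ≈⟨ *-congʳ (*-congʳ (D-peel s<n)) ⟩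
      fac true (2 * suc s) ⊛ D (suc s) n ⊛ q^ (2 * (s * n + tri s)) ⊛ q^ (2 * (s + suc n))
        ≈⟨ solve 4 (λ a b c d → a :* b :* c :* d := b :* (c :* d) :* a) ≈-refl
             (fac true (2 * suc s)) (D (suc s) n) (q^ (2 * (s * n + tri s))) (q^ (2 * (s + suc n))) ⟩
      D (suc s) n ⊛ (q^ (2 * (s * n + tri s)) ⊛ q^ (2 * (s + suc n))) ⊛ fac true (2 * suc s)
        ≈⟨ *-congʳ (*-congˡ (q^-+ _ _ (eq n s (tri s)))) ⟨
      V n (suc s) ∎
      where
      open ≈R
      eq : ∀ n s t → 2 * (suc s * n + (t + suc s)) ≡ 2 * (s * n + t) + 2 * (s + suc n)
      eq = solve-∀

    V-zero : ∀ n → V n 0 ≈ 𝟘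
    V-zero n = solve 1 (λ a → a :* (con true :+ con true) := con false) ≈-refl (P n 0)

    diagonal : ∀ {n s} k → n ≤ s → 2 * (s * n + tri s) + k ≡ 2 * (suc n * suc n + tri n) →
               P n s ⊛ q^ k ≈ q^ (2 * (suc n * suc n + tri n))
    diagonal {n} {s} k n≤s eq = begin
      D s n ⊛ q^ (2 * (s * n + tri s)) ⊛ q^ k     ≈⟨ *-congʳ (*-congʳ (D-empty n n≤s)) ⟩
      q^ 0 ⊛ q^ (2 * (s * n + tri s)) ⊛ q^ k      ≈⟨ solve 2 (λ a b → con true :* a :* b := a :* b) ≈-refl (q^ (2 * (s * n + tri s))) (q^ k) ⟩
      q^ (2 * (s * n + tri s)) ⊛ q^ k             ≈⟨ q^-+ _ _ (sym eq) ⟨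
      q^ (2 * (suc n * suc n + tri n))            ∎
      where open ≈R

    -- Induction on n by comparing rows n + 1 and n. The terms s < n telescope to `V n n`, which
    -- cancels against the one from s = n. What survives is the diagonal leftover x, the exponent at
    -- m = -(n+1), and the new last entry c, the exponent at m = n + 1.
    shanks : ∀ n → ∑ (P n) (suc n) ≈ pent n
    shanks zero    = solve 0 (con false :+ con true :* con true := con true :+ con false) ≈-refl
    shanks (suc n) = begin
      a ⊕ b ⊕ c
        ≈⟨ solve 6 (λ a b c d e v → a :+ b :+ c := (a :+ d) :+ (b :+ e) :+ (d :+ e) :+ c) ≈-refl a b c d e v ⟩
      (a ⊕ d) ⊕ (b ⊕ e) ⊕ (d ⊕ e) ⊕ c
        ≈⟨ +-congʳ (+-cong (+-cong (∑-telescope (V n) n λ s s<n → ≈-trans (step (<⇒≤ s<n)) (+-congˡ (carry s<n)))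
                                    (step ≤-refl)) (shanks n)) ⟩
      (V n 0 ⊕ v) ⊕ (v ⊕ P n n ⊛ q^ (2 * (n + suc n))) ⊕ pent n ⊕ c
        ≈⟨ +-cong (+-congʳ (+-cong (+-congʳ (V-zero n))
             (+-congˡ {v} (diagonal {n} {n} (2 * (n + suc n)) ≤-refl (eq n (tri n)))))) lastTerm ⟩
      (𝟘 ⊕ v) ⊕ (v ⊕ x) ⊕ pent n ⊕ y
        ≈⟨ solve 5 (λ v x p s y → (con false :+ v) :+ (v :+ x) :+ (con true :+ s) :+ y := con true :+ (s :+ (x :+ y)))
             ≈-refl v x (pent n) σ y ⟩
      pent (suc n) ∎
      where
      open ≈R
      a = ∑ (P (suc n)) n
      b = P (suc n) n
      c = P (suc n) (suc n)
      d = ∑ (P n) n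
      e = P n n
      v = V n n
      x = q^ (2 * (suc n * suc n + tri n))
      y = q^ (2 * (suc n * suc n + tri (suc n)))
      σ = ∑ (λ s → q^ (2 * (suc s * suc s + tri s)) ⊕ q^ (2 * (suc s * suc s + tri (suc s)))) n
      eq : ∀ n t → 2 * (n * n + t) + 2 * (n + suc n) ≡ 2 * (suc n * suc n + t)
      eq = solve-∀
      lastTerm : c ≈ y
      lastTerm = ≈-trans (*-congʳ (D-empty (suc n) ≤-refl)) (solve 1 (λ y → con true :* y := y) ≈-refl y)

    pentagonal : ∀ {n} → N ≤ n → D 0 n ≈ pent n
    pentagonal {n} N≤n = begin
      D 0 n
        ≈⟨ solve 1 (λ d → d := d :* con true :+ con false) ≈-refl (D 0 n) ⟩
      P n 0 ⊕ 𝟘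
        ≈⟨ +-congˡ (∑-vanish n λ s _ → ⊛-vanish (D (suc s) n) (q^-vanish (bound s))) ⟨
      P n 0 ⊕ ∑ (λ s → P n (suc s)) n
        ≈⟨ ∑-head (P n) n ⟨
      ∑ (P n) (suc n)
        ≈⟨ shanks n ⟩
      pent n ∎
      where
      open ≈R
      bound : ∀ s → N ≤ 2 * (suc s * n + tri (suc s))
      bound s = ≤-trans N≤n (≤-trans (m≤m+n n (s * n)) (≤-trans (m≤m+n _ _) (m≤m+n _ _)))

  -- Shanks' identity for (q²;q²)_n / (q;q²)_n, multiplied by (q;q²)_n to avoid division.
  module Gauss where

    U V : ℕ → ℕ → Series
    U n s = D s n ⊛ O s ⊛ q^ (s * (2 * n + 1))
    V n s = U n s ⊛ fac true (2 * s)

    ψ : ℕ → Series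
    ψ n = ∑ (λ t → q^ (tri t)) (2 * n)

    U-suc : ∀ {n s} → s ≤ n → U (suc n) s ≈ U n s ⊛ fac true (2 * suc n) ⊛ q^ (2 * s)
    U-suc {n} {s} s≤n = begin
      D s (suc n) ⊛ O s ⊛ q^ (s * (2 * suc n + 1))
        ≈⟨ ⊛-cong (*-congʳ (D-step s≤n)) (q^-+ _ _ (eq n s)) ⟩
      D s n ⊛ fac true (2 * suc n) ⊛ O s ⊛ (q^ (s * (2 * n + 1)) ⊛ q^ (2 * s))
        ≈⟨ solve 5 (λ d f o x y → d :* f :* o :* (x :* y) := d :* o :* x :* f :* y) ≈-refl
             (D s n) (fac true (2 * suc n)) (O s) (q^ (s * (2 * n + 1))) (q^ (2 * s)) ⟩
      U n s ⊛ fac true (2 * suc n) ⊛ q^ (2 * s) ∎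
      where
      open ≈R
      eq : ∀ n s → s * (2 * suc n + 1) ≡ s * (2 * n + 1) + 2 * s
      eq = solve-∀

    V-suc : ∀ {n s} → s < n → V n (suc s) ≈ U n s ⊛ q^ (2 * n + 1) ⊛ fac true (2 * s + 1)
    V-suc {n} {s} s<n = begin
      D (suc s) n ⊛ (O s ⊛ o) ⊛ q^ (suc s * (2 * n + 1)) ⊛ f
        ≈⟨ *-congʳ (*-congˡ (q^-+ (2 * n + 1) (s * (2 * n + 1)) refl)) ⟩
      D (suc s) n ⊛ (O s ⊛ o) ⊛ (q^ (2 * n + 1) ⊛ q^ (s * (2 * n + 1))) ⊛ f
        ≈⟨ solve 6 (λ d p o x y f → d :* (p :* o) :* (x :* y) :* f := f :* d :* p :* y :* x :* o) ≈-refl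
             (D (suc s) n) (O s) o (q^ (2 * n + 1)) (q^ (s * (2 * n + 1))) f ⟩
      f ⊛ D (suc s) n ⊛ O s ⊛ q^ (s * (2 * n + 1)) ⊛ q^ (2 * n + 1) ⊛ o
        ≈⟨ *-congʳ (*-congʳ (*-congʳ (*-congʳ (D-peel s<n)))) ⟨
      U n s ⊛ q^ (2 * n + 1) ⊛ o ∎
      where
      open ≈R
      o = fac true (2 * s + 1)
      f = fac true (2 * suc s)

    -- Row n is scaled by `O n` and row n + 1 by `O (suc n)`, so row n receives the new factor 1 +
    -- q^{2n+1} before the comparison. With z = q^{2n+1} and x = q^{2s}, the core is (1 + zq)x + (1
    -- + z) = (1 + x) + z(1 + xq).
    step : ∀ {n s} → s < n → U (suc n) s ⊕ fac true (2 * n + 1) ⊛ U n s ≈ V n s ⊕ V n (suc s)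
    step {n} {s} s<n = begin
      U (suc n) s ⊕ fac true (2 * n + 1) ⊛ u
        ≈⟨ +-congʳ (≈-trans (U-suc (<⇒≤ s<n)) (*-congʳ (*-congˡ (+-congˡ (q^-+ (2 * n + 1) 1 (eq n)))))) ⟩
      u ⊛ (q^ 0 ⊕ z ⊛ q^ 1) ⊛ x ⊕ fac true (2 * n + 1) ⊛ u
        ≈⟨ solve 4 (λ u z q x → u :* (con true :+ z :* q) :* x :+ (con true :+ z) :* u
                            := u :* (con true :+ x) :+ u :* z :* (con true :+ x :* q)) ≈-refl u z (q^ 1) x ⟩
      V n s ⊕ u ⊛ z ⊛ (q^ 0 ⊕ x ⊛ q^ 1)
        ≈⟨ +-congˡ (*-congˡ (+-congˡ (q^-+ (2 * s) 1 refl))) ⟨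
      V n s ⊕ u ⊛ z ⊛ fac true (2 * s + 1)
        ≈⟨ +-congˡ (V-suc s<n) ⟨
      V n s ⊕ V n (suc s) ∎
      where
      open ≈R
      u = U n s
      z = q^ (2 * n + 1)
      x = q^ (2 * s)
      eq : ∀ n → 2 * suc n ≡ 2 * n + 1 + 1
      eq = solve-∀

    tri-double : ∀ n → tri (2 * n) ≡ n * (2 * n + 1)
    tri-double zero    = refl
    tri-double (suc n) = begin
      tri (2 * suc n)                     ≡⟨ cong tri (e₁ n) ⟩
      tri (2 * n) + suc (2 * n) + suc (suc (2 * n)) ≡⟨ cong (λ t → t + suc (2 * n) + suc (suc (2 * n))) (tri-double n) ⟩
      n * (2 * n + 1) + suc (2 * n) + suc (suc (2 * n)) ≡⟨ e₂ n ⟩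
      suc n * (2 * suc n + 1)             ∎
      where
      open ≡-Reasoning
      e₁ : ∀ n → 2 * suc n ≡ suc (suc (2 * n))
      e₁ = solve-∀
      e₂ : ∀ n → n * (2 * n + 1) + suc (2 * n) + suc (suc (2 * n)) ≡ suc n * (2 * suc n + 1)
      e₂ = solve-∀

    shanks : ∀ n → ∑ (U n) n ≈ O n ⊛ ψ n
    shanks zero    = solve 0 (con false := con true :* con false) ≈-refl
    shanks (suc n) = begin
      a ⊕ U (suc n) n
        ≈⟨ solve 3 (λ a b c → a :+ b := (a :+ c) :+ b :+ c) ≈-refl a (U (suc n) n) (f ⊛ ∑ (U n) n) ⟩
      (a ⊕ f ⊛ ∑ (U n) n) ⊕ U (suc n) n ⊕ f ⊛ ∑ (U n) n
        ≈⟨ +-cong (+-cong (≈-trans (+-congˡ (≈-sym (∑-⊛ f (U n) n))) (∑-telescope (V n) n λ s s<n → step s<n))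
                           (U-suc ≤-refl)) (*-congˡ (shanks n)) ⟩
      (V n 0 ⊕ V n n) ⊕ U n n ⊛ fac true (2 * suc n) ⊛ x ⊕ f ⊛ (O n ⊛ ψ n)
        ≈⟨ +-congʳ (+-cong (+-cong (solve 1 (λ a → a :* (con true :+ con true) := con false) ≈-refl (U n 0))
              (*-congʳ Unn)) (*-congʳ (⊛-cong Unn (+-congˡ (q^-+ (2 * n) 2 (e₁ n)))))) ⟩
      (𝟘 ⊕ O n ⊛ t ⊛ fac true (2 * n)) ⊕ O n ⊛ t ⊛ (q^ 0 ⊕ x ⊛ q^ 2) ⊛ x ⊕ f ⊛ (O n ⊛ ψ n)
        -- Writing q² as q·q lets the solver see t(1 + x) + t(1 + xq²)x = t(1 + xq)². One factor 1 +
        -- xq extends `O n`; the other yields the next two triangular powers t and t·xq.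
        ≈⟨ +-congʳ (+-congˡ (*-congʳ (*-congˡ (+-congˡ (*-congˡ (q^-+ 1 1 refl)))))) ⟩
      (𝟘 ⊕ O n ⊛ t ⊛ fac true (2 * n)) ⊕ O n ⊛ t ⊛ (q^ 0 ⊕ x ⊛ (q^ 1 ⊛ q^ 1)) ⊛ x ⊕ f ⊛ (O n ⊛ ψ n)
        ≈⟨ +-congˡ (*-congʳ (+-congˡ (q^-+ (2 * n) 1 refl))) ⟩
      (𝟘 ⊕ O n ⊛ t ⊛ fac true (2 * n)) ⊕ O n ⊛ t ⊛ (q^ 0 ⊕ x ⊛ (q^ 1 ⊛ q^ 1)) ⊛ x ⊕ (q^ 0 ⊕ x ⊛ q^ 1) ⊛ (O n ⊛ ψ n)
        ≈⟨ solve 5 (λ o t x q p → (con false :+ o :* t :* (con true :+ x)) :+ o :* t :* (con true :+ x :* (q :* q)) :* x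
                        :+ (con true :+ x :* q) :* (o :* p)
                 := o :* (con true :+ x :* q) :* (p :+ t :+ t :* (x :* q))) ≈-refl (O n) t x (q^ 1) (ψ n) ⟩
      O n ⊛ (q^ 0 ⊕ x ⊛ q^ 1) ⊛ (ψ n ⊕ t ⊕ t ⊛ (x ⊛ q^ 1))
        ≈⟨ ⊛-cong (*-congˡ (+-congˡ (≈-sym (q^-+ (2 * n) 1 refl)))) (+-congˡ (*-congˡ (≈-sym (q^-+ (2 * n) 1 refl)))) ⟩
      O n ⊛ f ⊛ (ψ n ⊕ t ⊕ t ⊛ q^ (2 * n + 1))
        ≈⟨ *-congˡ (+-cong (+-congˡ {ψ n} (reflexive (cong q^_ (sym (tri-double n))))) (≈-sym (q^-+ _ _ e₃))) ⟩
      O n ⊛ f ⊛ (ψ n ⊕ q^ (tri (2 * n)) ⊕ q^ (tri (suc (2 * n))))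
        ≡⟨ cong (λ k → O n ⊛ f ⊛ ∑ (λ t → q^ (tri t)) k) (sym (e₂ n)) ⟩
      O (suc n) ⊛ ψ (suc n) ∎
      where
      open ≈R
      a = ∑ (U (suc n)) n
      f = fac true (2 * n + 1)
      x = q^ (2 * n)
      t = q^ (n * (2 * n + 1))
      Unn : U n n ≈ O n ⊛ t
      Unn = *-congʳ (≈-trans (*-congʳ (D-empty n ≤-refl)) (solve 1 (λ o → con true :* o := o) ≈-refl (O n)))
      e₁ : ∀ n → 2 * suc n ≡ 2 * n + 2
      e₁ = solve-∀
      e₂ : ∀ n → 2 * suc n ≡ suc (suc (2 * n))
      e₂ = solve-∀
      e₃ : tri (2 * n) + suc (2 * n) ≡ n * (2 * n + 1) + (2 * n + 1)
      e₃ = cong₂ _+_ (tri-double n) (ℕ.+-comm 1 (2 * n))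

    gauss : ∀ {n} → N ≤ suc n → D 0 (suc n) ≈ O (suc n) ⊛ ψ (suc n)
    gauss {n} N≤n = begin
      D 0 m                              ≈⟨ solve 1 (λ d → d := d :* con true :* con true :+ con false) ≈-refl (D 0 m) ⟩
      U m 0 ⊕ 𝟘                         ≈⟨ +-congˡ (∑-vanish n λ s _ → ⊛-vanish (D (suc s) m ⊛ O (suc s)) (q^-vanish (bound s))) ⟨
      U m 0 ⊕ ∑ (λ s → U m (suc s)) n   ≈⟨ ∑-head (U m) n ⟨
      ∑ (U m) m                         ≈⟨ shanks m ⟩
      O m ⊛ ψ m                         ∎
      where
      open ≈R
      m = suc n
      bound : ∀ s → N ≤ suc s * (2 * m + 1)
      bound s = ≤-trans N≤n (≤-trans (m≤m+n m _) (≤-trans (m≤m+n _ 1) (m≤m+n _ _)))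

  -- Euler's functional equation f(z) = (1 + zq) f(zq²) for f(z) = Σ_j z^j q^{j²}/(q²;q²)_j,
  -- at z = q^{2s} and scaled by (q²;q²)_M.
  module Euler (m : ℕ) (N≤m : N ≤ suc m) where

    M = suc m

    A : ℕ → ℕ → Series
    A s j = D j M ⊛ q^ (j * j + 2 * s * j)

    A-shift : ∀ s j → A (suc s) j ≈ A s j ⊛ q^ (2 * j)
    A-shift s j = ≈-trans (*-congˡ {D j M} (q^-+ _ _ (eq s j))) (≈-sym (*-assoc (D j M) _ _))
      where
      eq : ∀ s j → j * j + 2 * suc s * j ≡ j * j + 2 * s * j + 2 * j
      eq = solve-∀

    -- In f(z) - f(zq²) the j-th term acquires 1 + q^{2j}, which cancels the last factor of
    -- (q²;q²)_j, so it equals the term of index j - 1 in zq f(zq²). Hence the functional equation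
    -- holds up to an index shift, which is a telescoping sum.
    step : ∀ s j → j < M → A s j ⊕ fac true (2 * s + 1) ⊛ A (suc s) j
                        ≈ A s j ⊛ fac true (2 * j) ⊕ A s (suc j) ⊛ fac true (2 * suc j)
    step s j j<M = begin
      A s j ⊕ fac true (2 * s + 1) ⊛ A (suc s) j
        ≈⟨ +-congˡ (*-congˡ (A-shift s j)) ⟩
      A s j ⊕ fac true (2 * s + 1) ⊛ (A s j ⊛ y)
        ≈⟨ +-congˡ (*-congˡ (*-congʳ (*-congʳ (D-peel j<M)))) ⟩
      A s j ⊕ fac true (2 * s + 1) ⊛ (f ⊛ d ⊛ e ⊛ y)
        ≈⟨ +-congʳ (*-congʳ (D-peel j<M)) ⟩
      f ⊛ d ⊛ e ⊕ fac true (2 * s + 1) ⊛ (f ⊛ d ⊛ e ⊛ y)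
        ≈⟨ solve 5 (λ f d e x y → f :* d :* e :+ (con true :+ x) :* (f :* d :* e :* y)
                    := f :* d :* e :* (con true :+ y) :+ d :* (e :* (y :* x)) :* f) ≈-refl f d e x y ⟩
      f ⊛ d ⊛ e ⊛ fac true (2 * j) ⊕ d ⊛ (e ⊛ (y ⊛ x)) ⊛ f
        ≈⟨ +-cong (*-congʳ (*-congʳ (D-peel j<M)))
             (*-congʳ (*-congˡ (≈-trans (q^-+ (j * j + 2 * s * j) (2 * j + (2 * s + 1)) (eq s j)) (*-congˡ (q^-+ (2 * j) _ refl))))) ⟨
      A s j ⊛ fac true (2 * j) ⊕ A s (suc j) ⊛ f ∎
      where
      open ≈R
      f = fac true (2 * suc j)
      d = D (suc j) M
      e = q^ (j * j + 2 * s * j)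
      x = q^ (2 * s + 1)
      y = q^ (2 * j)
      eq : ∀ s j → suc j * suc j + 2 * s * suc j ≡ j * j + 2 * s * j + (2 * j + (2 * s + 1))
      eq = solve-∀

    A-vanish : ∀ s → A s M ≈ 𝟘
    A-vanish s = ⊛-vanish (D M M) (q^-vanish (≤-trans N≤m (≤-trans (m≤m+n M _) (m≤m+n _ _))))

    functional : ∀ s → ∑ (A s) M ≈ fac true (2 * s + 1) ⊛ ∑ (A (suc s)) M
    functional s = begin
      a                ≈⟨ solve 2 (λ a b → a := (a :+ b) :+ b) ≈-refl a b ⟩
      (a ⊕ b) ⊕ b     ≈⟨ +-congʳ (+-congˡ (∑-⊛ x (A (suc s)) M)) ⟨
      (a ⊕ ∑ (λ j → x ⊛ A (suc s) j) M) ⊕ b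
                       ≈⟨ +-congʳ (∑-telescope (λ j → A s j ⊛ fac true (2 * j)) M (step s)) ⟩
      (A s 0 ⊛ fac true 0 ⊕ A s M ⊛ fac true (2 * M)) ⊕ b
                       ≈⟨ +-congʳ (+-congˡ (*-congʳ (A-vanish s))) ⟩
      (A s 0 ⊛ fac true 0 ⊕ 𝟘 ⊛ fac true (2 * M)) ⊕ b
                       ≈⟨ solve 3 (λ a f b → (a :* (con true :+ con true) :+ con false :* f) :+ b := b) ≈-refl (A s 0) (fac true (2 * M)) b ⟩
      b                ∎
      where
      open ≈R
      x = fac true (2 * s + 1)
      a = ∑ (A s) M
      b = x ⊛ ∑ (A (suc s)) M

    iterated : ∀ L → ∑ (A 0) M ≈ O L ⊛ ∑ (A L) M
    iterated zero    = solve 1 (λ a → a := con true :* a) ≈-refl (∑ (A 0) M)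
    iterated (suc L) = ≈-trans (iterated L) (≈-trans (*-congˡ (functional L)) (≈-sym (*-assoc (O L) _ _)))

    -- After M iterations z = q^{2M} is 0 modulo q^N, so only the term j = 0 of the remaining sum
    -- survives.
    euler : ∑ (A 0) M ≈ O M ⊛ D 0 M
    euler = ≈-trans (iterated M) (*-congˡ (begin
      ∑ (A M) M                        ≈⟨ ∑-head (A M) m ⟩
      A M 0 ⊕ ∑ (λ j → A M (suc j)) m  ≈⟨ +-cong (*-congˡ (reflexive (cong q^_ (*-zeroʳ (2 * M)))))
                                         (∑-vanish m λ j _ → ⊛-vanish (D (suc j) M) (q^-vanish (bound j))) ⟩
      D 0 M ⊛ q^ 0 ⊕ 𝟘                ≈⟨ solve 1 (λ d → d :* con true :+ con false := d) ≈-refl (D 0 M) ⟩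
      D 0 M                            ∎))
      where
      open ≈R
      bound : ∀ j → N ≤ suc j * suc j + 2 * M * suc j
      bound j = ≤-trans N≤m (≤-trans (m≤m+n M (M + 0)) (≤-trans (m≤m*n (2 * M) (suc j)) (m≤n+m _ (suc j * suc j))))

  -- The product for a fixed j, and the sum over j

  fac-true-false : ∀ k → fac true k ≈ fac true k ⊛ fac false k
  fac-true-false k = solve 1 (λ x → con true :+ x := (con true :+ x) :* (con true :+ con false)) ≈-refl (q^ k)

  fac-false-true : ∀ k → fac true k ≈ fac false k ⊛ fac true k
  fac-false-true k = ≈-trans (fac-true-false k) (*-comm (fac true k) (fac false k))

  -- Frobenius in characteristic 2.
  fac-square : ∀ b k → fac b (2 * k) ≈ fac b k ⊛ fac b k
  fac-square false k = solve 0 (con true :+ con false := (con true :+ con false) :* (con true :+ con false)) ≈-refl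
  fac-square true  k = ≈-trans (+-congˡ (q^-+ k (k + 0) refl)) (≈-trans (reflexive (cong (λ l → q^ 0 ⊕ q^ k ⊛ q^ l) (ℕ.+-identityʳ k)))
    (solve 1 (λ x → con true :+ x :* x := (con true :+ x) :* (con true :+ x)) ≈-refl (q^ k)))

  -- The part 4i + 4 is admissible if it is at most 2j or at least 4j + 4. These alternatives
  -- exclude each other, so at most one of the two factors is switched on.
  ok-0mod4 : ∀ j i y → fac (okMult j 1 (2 * suc (2 * i + 1))) y ≈ fac (suc (2 * i + 1) ≤ᵇ j) y ⊛ fac (j ≤ᵇ i) y
  ok-0mod4 j i y with <-≤-connex (2 * i + 1) j
  ... | inj₁ k<j rewrite ok-even-small k<j | ≤⇒≤ᵇ≡ k<j
                       | >⇒≤ᵇ≡ {j} {i} (≤-<-trans (≤-trans (m≤m+n i (i + 0)) (m≤m+n (2 * i) 1)) k<j) = fac-true-false y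
  ... | inj₂ j≤k rewrite ok-even-large j≤k | >⇒≤ᵇ≡ (s≤s j≤k) | 4+4i%4 i
    with <-≤-connex i j
  ... | inj₁ i<j rewrite >⇒≤ᵇ≡ i<j
          | >⇒≤ᵇ≡ {4 * j + 4} {2 * suc (2 * i + 1)} (≤-<-trans (≤-trans (≤-reflexive (sym (4+4i i))) (*-monoʳ-≤ 4 i<j))
              (m<m+n (4 * j) (s≤s z≤n)))
      = solve 0 (con true :+ con false := (con true :+ con false) :* (con true :+ con false)) ≈-refl
  ... | inj₂ j≤i rewrite ≤⇒≤ᵇ≡ j≤i | ≤⇒≤ᵇ≡ {4 * j + 4} {2 * suc (2 * i + 1)} (4j+4≤ j≤i)
          | >⇒≤ᵇ≡ {2 * suc (2 * i + 1)} {4 * j + 2} (<-≤-trans (+-monoʳ-< (4 * j) (s≤s (s≤s (s≤s z≤n)))) (4j+4≤ j≤i))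
      = fac-false-true y

  ∏-fac-stable : ∀ (b : ℕ → Bool) (e : ℕ → ℕ) {n} k → (∀ i → n ≤ i → N ≤ e i) →
                 ∏ (λ i → fac (b i) (e i)) (k + n) ≈ ∏ (λ i → fac (b i) (e i)) n
  ∏-fac-stable b e k p = ∏-stable (λ i → fac (b i) (e i)) k λ i n≤i → fac-vanish (b i) (p i n≤i)

  double : ∀ m → 2 * m ≡ m + m
  double = solve-∀

  D-stable : ∀ j {M} → N ≤ M → D j (2 * M) ≈ D j M
  D-stable j {M} N≤M = ≈-trans (reflexive (cong (D j) (double M)))
    (∏-fac-stable (j ≤ᵇ_) (λ i → 2 * suc i) M λ i M≤i → ≤-trans N≤M (≤-trans M≤i (≤-trans (n≤1+n i) (m≤m+n _ _))))

  O-stable : ∀ {M} → N ≤ M → O (2 * M) ≈ O M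
  O-stable {M} N≤M = ≈-trans (reflexive (cong O (double M)))
    (∏-fac-stable (λ _ → true) (λ i → 2 * i + 1) M λ i M≤i → ≤-trans N≤M (≤-trans M≤i (≤-trans (m≤m+n i (i + 0)) (m≤m+n _ 1))))

  H-odd : ∀ j m → ∏ (λ i → fac (okMult j 1 (suc (2 * i))) (suc (2 * i))) m ≈ O m
  H-odd j m = ∏-cong m λ i _ → reflexive (cong₂ fac (ok-odd j i) (ℕ.+-comm 1 (2 * i)))

  low : ℕ → ℕ → Series
  low j m = ∏ (λ i → fac (suc i ≤ᵇ j) (2 * suc i)) m

  low-D : ∀ j m → low j m ⊛ D j m ≈ D 0 m
  low-D j m = ≈-trans (≈-sym (∏-⊛ (λ i → fac (suc i ≤ᵇ j) (2 * suc i)) (λ i → fac (j ≤ᵇ i) (2 * suc i)) m))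
    (∏-cong m λ i _ → complement i)
    where
    complement : ∀ i → fac (suc i ≤ᵇ j) (2 * suc i) ⊛ fac (j ≤ᵇ i) (2 * suc i) ≈ fac true (2 * suc i)
    complement i with <-≤-connex i j
    ... | inj₁ i<j rewrite ≤⇒≤ᵇ≡ i<j | >⇒≤ᵇ≡ i<j = ≈-sym (fac-true-false (2 * suc i))
    ... | inj₂ j≤i rewrite >⇒≤ᵇ≡ (s≤s j≤i) | ≤⇒≤ᵇ≡ j≤i = ≈-sym (fac-false-true (2 * suc i))

  suc-odd : ∀ i → suc (2 * i + 1) ≡ 2 * suc i
  suc-odd = solve-∀

  -- Even parts up to 2j give `low`. The larger ones are the multiples of 4 from 4j + 4 on, and by
  -- Frobenius the product of the 1 + q^{4(i+1)} with i ≥ j is the square of `D j m`.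
  H-even : ∀ j m → ∏ (λ i → fac (okMult j 1 (suc (2 * i + 1))) (suc (2 * i + 1))) (2 * m) ≈ low j (2 * m) ⊛ (D j m ⊛ D j m)
  H-even j m = begin
    ∏ (λ i → fac (okMult j 1 (suc (2 * i + 1))) (suc (2 * i + 1))) (2 * m)
      ≈⟨ ∏-cong (2 * m) (λ i _ → reflexive (cong (λ x → fac (okMult j 1 x) x) (suc-odd i))) ⟩
    ∏ (λ i → fac (okMult j 1 (2 * suc i)) (2 * suc i)) (2 * m)
      ≈⟨ ∏-parity _ m ⟩
    ∏ (λ i → fac (okMult j 1 (2 * suc (2 * i))) (2 * suc (2 * i))) m ⊛
      ∏ (λ i → fac (okMult j 1 (2 * suc (2 * i + 1))) (2 * suc (2 * i + 1))) m
      ≈⟨ ⊛-cong (∏-cong m λ i _ → reflexive (cong (λ b → fac b (2 * suc (2 * i))) (ok-2mod4 j i)))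
                (≈-trans (∏-cong m λ i _ → ok-0mod4 j i (2 * suc (2 * i + 1))) (∏-⊛ _ _ m)) ⟩
    ∏ (λ i → g (2 * i)) m ⊛ (∏ (λ i → g (2 * i + 1)) m ⊛ ∏ (λ i → fac (j ≤ᵇ i) (2 * suc (2 * i + 1))) m)
      ≈⟨ *-assoc (∏ (λ i → g (2 * i)) m) _ _ ⟨
    ∏ (λ i → g (2 * i)) m ⊛ ∏ (λ i → g (2 * i + 1)) m ⊛ ∏ (λ i → fac (j ≤ᵇ i) (2 * suc (2 * i + 1))) m
      ≈⟨ ⊛-cong (≈-sym (∏-parity g m))
           (≈-trans (∏-cong m λ i _ → ≈-trans (reflexive (cong (λ y → fac (j ≤ᵇ i) (2 * y)) (suc-odd i)))
                                                    (fac-square (j ≤ᵇ i) (2 * suc i))) (∏-⊛ _ _ m)) ⟩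
    low j (2 * m) ⊛ (D j m ⊛ D j m) ∎
    where
    open ≈R
    g = λ i → fac (suc i ≤ᵇ j) (2 * suc i)

  H-product : ∀ j {M} → N ≤ M → H j (2 * (2 * M)) ≈ O M ⊛ D 0 M ⊛ D j M
  H-product j {M} N≤M = begin
    H j (2 * (2 * M))
      ≈⟨ ∏-parity _ (2 * M) ⟩
    _ ⊛ _
      ≈⟨ ⊛-cong (≈-trans (H-odd j (2 * M)) (O-stable N≤M)) (H-even j M) ⟩
    O M ⊛ (low j (2 * M) ⊛ (D j M ⊛ D j M))
      -- One copy of `D j M` is lengthened to the range of `low j (2 * M)`, which it then completes
      -- to the full product; the other copy stays and plays the role of 1/(q²;q²)_j.
      ≈⟨ *-congˡ (*-congˡ (*-congʳ (D-stable j N≤M))) ⟨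
    O M ⊛ (low j (2 * M) ⊛ (D j (2 * M) ⊛ D j M))
      ≈⟨ *-congˡ (*-assoc (low j (2 * M)) _ _) ⟨
    O M ⊛ (low j (2 * M) ⊛ D j (2 * M) ⊛ D j M)
      ≈⟨ *-congˡ (*-congʳ (≈-trans (low-D j (2 * M)) (D-stable 0 N≤M))) ⟩
    O M ⊛ (D 0 M ⊛ D j M)
      ≈⟨ *-assoc (O M) _ _ ⟨
    O M ⊛ D 0 M ⊛ D j M ∎
    where open ≈R

  -- O times D 0 is the product of all 1 + q^k with k ≤ 2M; squaring doubles every exponent, which
  -- gives D 0 again with twice as many factors.
  OOEE : ∀ {M} → N ≤ M → (O M ⊛ O M) ⊛ (D 0 M ⊛ D 0 M) ≈ D 0 M
  OOEE {M} N≤M = begin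
    (O M ⊛ O M) ⊛ (D 0 M ⊛ D 0 M)
      ≈⟨ ⊛-cong (∏-⊛ o o M) (∏-⊛ e e M) ⟨
    ∏ (λ i → o i ⊛ o i) M ⊛ ∏ (λ i → e i ⊛ e i) M
      ≈⟨ ⊛-cong (∏-cong M λ i _ → fac-square true (2 * i + 1)) (∏-cong M λ i _ → fac-square true (2 * suc i)) ⟨
    ∏ (λ i → fac true (2 * (2 * i + 1))) M ⊛ ∏ (λ i → fac true (2 * (2 * suc i))) M
      ≈⟨ ⊛-cong (∏-cong M λ i _ → reflexive (cong (λ y → fac true (2 * y)) (ℕ.+-comm 1 (2 * i))))
                (∏-cong M λ i _ → reflexive (cong (λ y → fac true (2 * y)) (suc-odd i))) ⟨
    ∏ (λ i → e (2 * i)) M ⊛ ∏ (λ i → e (2 * i + 1)) M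
      ≈⟨ ∏-parity e M ⟨
    D 0 (2 * M)
      ≈⟨ D-stable 0 N≤M ⟩
    D 0 M ∎
    where
    open ≈R
    o = λ i → fac true (2 * i + 1)
    e = λ i → fac true (2 * suc i)

  opaque
    unfolding 𝟘 q^_ _⊕_ _⊛_

    cancel : ∀ {f g h} → h 0 ≡ true → f ⊛ h ≈ g ⊛ h → f ≈ g
    cancel {f} {g} {h} h₀ p = agree λ i i<N → xor-false (f i) (g i) (⊛-cancel-zero (f ⊕ g) h h₀ (coeff fh+gh≈0) i i<N)
      where
      xor-false : ∀ a b → a xor b ≡ false → a ≡ b
      xor-false false b     p = sym p
      xor-false true  true  p = refl
      fh+gh≈0 : (f ⊕ g) ⊛ h ≈ 𝟘
      fh+gh≈0 = ≈-trans (solve 3 (λ f g h → (f :+ g) :* h := f :* h :+ g :* h) ≈-refl f g h)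
        (≈-trans (+-congʳ p) (solve 1 (λ x → x :+ x := con false) ≈-refl (g ⊛ h)))

    D-constant : ∀ m → D 0 m 0 ≡ true
    D-constant zero    = refl
    D-constant (suc m) = trans (∧-identityʳ _) (D-constant m)

  -- Write o and e for the two products. Gauss gives e = oψ and `OOEE` gives o²e² = e, so formally
  -- oe² = e/o = ψ. To avoid the quotient, both sides are multiplied by e, whose constant term is 1,
  -- and e is cancelled at the end.
  theta : ∀ {m} → N ≤ suc m → O (suc m) ⊛ D 0 (suc m) ⊛ D 0 (suc m) ≈ Gauss.ψ (suc m)
  theta {m} N≤M = cancel (D-constant (suc m)) (begin
    o ⊛ e ⊛ e ⊛ e       ≈⟨ solve 2 (λ o e → o :* e :* e :* e := e :* (o :* e :* e)) ≈-refl o e ⟩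
    e ⊛ (o ⊛ e ⊛ e)     ≈⟨ *-congʳ (Gauss.gauss N≤M) ⟩
    o ⊛ ψ ⊛ (o ⊛ e ⊛ e) ≈⟨ solve 3 (λ o e p → o :* p :* (o :* e :* e) := p :* ((o :* o) :* (e :* e))) ≈-refl o e ψ ⟩
    ψ ⊛ ((o ⊛ o) ⊛ (e ⊛ e)) ≈⟨ *-congˡ (OOEE N≤M) ⟩
    ψ ⊛ e               ∎)
    where
    open ≈R
    o = O (suc m)
    e = D 0 (suc m)
    ψ = Gauss.ψ (suc m)

  generating : ∀ n → N ≤ suc n →
    ∑ (λ i → q^ (suc i * suc i) ⊛ H (suc i) n) n ≈ Pentagonal.pent (suc n) ⊕ Gauss.ψ (suc n)
  generating n N≤M = begin
    ∑ (λ i → q^ (suc i * suc i) ⊛ H (suc i) n) n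
      ≈⟨ ∑-cong n (λ i _ → term (suc i)) ⟩
    ∑ (λ i → o ⊛ e ⊛ A 0 (suc i)) n
      ≈⟨ ∑-⊛ (o ⊛ e) (λ i → A 0 (suc i)) n ⟩
    o ⊛ e ⊛ σ
      -- The sum starts at j = 1. Adding the missing term j = 0 twice completes Euler's sum and
      -- leaves the theta product `o ⊛ e ⊛ e` over.
      ≈⟨ solve 3 (λ o e s → o :* e :* s := o :* e :* (e :* con true :+ s) :+ o :* e :* e) ≈-refl o e σ ⟩
    o ⊛ e ⊛ (A 0 0 ⊕ σ) ⊕ o ⊛ e ⊛ e
      ≈⟨ +-congʳ (*-congˡ (≈-trans (≈-sym (∑-head (A 0) n)) euler)) ⟩
    o ⊛ e ⊛ (o ⊛ e) ⊕ o ⊛ e ⊛ e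
      ≈⟨ +-congʳ (solve 2 (λ o e → o :* e :* (o :* e) := (o :* o) :* (e :* e)) ≈-refl o e) ⟩
    (o ⊛ o) ⊛ (e ⊛ e) ⊕ o ⊛ e ⊛ e
      ≈⟨ +-cong (≈-trans (OOEE N≤M) (Pentagonal.pentagonal N≤M)) (theta N≤M) ⟩
    Pentagonal.pent (suc n) ⊕ Gauss.ψ (suc n) ∎
    where
    open ≈R
    open Euler n N≤M using (A; euler)
    o = O (suc n)
    e = D 0 (suc n)
    σ = ∑ (λ i → A 0 (suc i)) n
    eq : ∀ n → 2 * (2 * suc n) ≡ (4 + 3 * n) + n
    eq = solve-∀
    term : ∀ j → q^ (j * j) ⊛ H j n ≈ o ⊛ e ⊛ A 0 j
    term j = begin
      q^ (j * j) ⊛ H j n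
        -- Parts exceeding n do not reach coefficients below N, so the range may grow to 4(n+1), a
        -- length that can be split by parity twice.
        ≈⟨ *-congˡ (∏-fac-stable (λ i → okMult j 1 (suc i)) suc (4 + 3 * n) λ i n≤i → ≤-trans N≤M (s≤s n≤i)) ⟨
      q^ (j * j) ⊛ H j ((4 + 3 * n) + n)
        ≡⟨ cong (λ k → q^ (j * j) ⊛ H j k) (sym (eq n)) ⟩
      q^ (j * j) ⊛ H j (2 * (2 * suc n))
        ≈⟨ *-congˡ (H-product j N≤M) ⟩
      q^ (j * j) ⊛ (o ⊛ e ⊛ D j (suc n))
        ≈⟨ solve 4 (λ q o e d → q :* (o :* e :* d) := o :* e :* (d :* q)) ≈-refl (q^ (j * j)) o e (D j (suc n)) ⟩
      o ⊛ e ⊛ (D j (suc n) ⊛ q^ (j * j))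
        ≡⟨ cong (λ k → o ⊛ e ⊛ (D j (suc n) ⊛ q^ k)) (sym (ℕ.+-identityʳ (j * j))) ⟩
      o ⊛ e ⊛ A 0 j ∎

  pent-split : ∀ K →
    Pentagonal.pent K ≈ ∑ (λ s → q^ (negExp s)) K ⊕ ∑ (λ s → q^ (posExp s)) (suc K)
  pent-split K = begin
    q^ 0 ⊕ ∑ (λ s → q^ (negExp s) ⊕ q^ (posExp (suc s))) K
      ≈⟨ +-congˡ (∑-⊕ (λ s → q^ (negExp s)) (λ s → q^ (posExp (suc s))) K) ⟩
    q^ 0 ⊕ (a ⊕ b)
      ≈⟨ solve 3 (λ x a b → x :+ (a :+ b) := a :+ (x :+ b)) ≈-refl (q^ 0) a b ⟩
    a ⊕ (q^ 0 ⊕ b)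
      ≈⟨ +-congˡ (∑-head (λ s → q^ (posExp s)) K) ⟨
    a ⊕ ∑ (λ s → q^ (posExp s)) (suc K) ∎
    where
    open ≈R
    a = ∑ (λ s → q^ (negExp s)) K
    b = ∑ (λ s → q^ (posExp (suc s))) K
    ∑-⊕ : ∀ f g n → ∑ (λ i → f i ⊕ g i) n ≈ ∑ f n ⊕ ∑ g n
    ∑-⊕ f g zero    = solve 0 (con false := con false :+ con false) ≈-refl
    ∑-⊕ f g (suc n) = ≈-trans (+-congʳ (∑-⊕ f g n))
      (solve 4 (λ a b c d → a :+ b :+ (c :+ d) := a :+ c :+ (b :+ d)) ≈-refl (∑ f n) (∑ g n) (f n) (g n))

-- Counting partitions modulo 2

xorSum : ∀ {A : Set} → (A → Bool) → List A → Bool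
xorSum P []       = false
xorSum P (x ∷ xs) = P x xor xorSum P xs

xorSum-++ : ∀ {A : Set} (P : A → Bool) xs ys → xorSum P (xs ++ ys) ≡ xorSum P xs xor xorSum P ys
xorSum-++ P []       ys = refl
xorSum-++ P (x ∷ xs) ys = trans (cong (P x xor_) (xorSum-++ P xs ys)) (sym (xor-assoc (P x) _ _))

xorSum-map : ∀ {A B : Set} (P : B → Bool) (f : A → B) xs → xorSum P (map f xs) ≡ xorSum (P ∘ f) xs
xorSum-map P f []       = refl
xorSum-map P f (x ∷ xs) = cong (P (f x) xor_) (xorSum-map P f xs)

xorSum-cong : ∀ {A : Set} {P Q : A → Bool} {xs} → All (λ x → P x ≡ Q x) xs → xorSum P xs ≡ xorSum Q xs
xorSum-cong []       = refl
xorSum-cong (p ∷ ps) = cong₂ _xor_ p (xorSum-cong ps)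

xorSum-∧ : ∀ {A : Set} b (P : A → Bool) xs → xorSum (λ x → b ∧ P x) xs ≡ b ∧ xorSum P xs
xorSum-∧ b P []       = sym (∧-zeroʳ b)
xorSum-∧ b P (x ∷ xs) = trans (cong (b ∧ P x xor_) (xorSum-∧ b P xs)) (sym (∧-distribˡ-xor b (P x) _))

xorSum-false : ∀ {A : Set} (xs : List A) → xorSum (λ _ → false) xs ≡ false
xorSum-false []       = refl
xorSum-false (x ∷ xs) = xorSum-false xs

xorSum-xor : ∀ {A : Set} (P Q : A → Bool) xs → xorSum (λ x → P x xor Q x) xs ≡ xorSum P xs xor xorSum Q xs
xorSum-xor P Q []       = refl
xorSum-xor P Q (x ∷ xs) = trans (cong ((P x xor Q x) xor_) (xorSum-xor P Q xs)) (xor-interchange (P x) (Q x) _ _)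

xorSum-swap : ∀ {A B : Set} (f : A → B → Bool) xs ys →
              xorSum (λ y → xorSum (λ x → f x y) xs) ys ≡ xorSum (λ x → xorSum (f x) ys) xs
xorSum-swap f []       ys = xorSum-false ys
xorSum-swap f (x ∷ xs) ys = trans (xorSum-xor (f x) _ ys) (cong (xorSum (f x) ys xor_) (xorSum-swap f xs ys))

-- With at most one disjunct true, "or" coincides with "xor". This turns the existential over j into
-- a sum over j.
any≡xorSum : ∀ {A : Set} {P : A → Bool} {xs} →
             AllPairs (λ x y → P x ≡ true → P y ≡ true → ⊥) xs → any P xs ≡ xorSum P xs
any≡xorSum []                               = refl
any≡xorSum {P = P} {x ∷ xs} (x# ∷ xs#) with P x in eq
... | false = any≡xorSum xs#
... | true  = cong not (sym (trans (xorSum-cong (All.map (λ h → excluded (h refl)) x#)) (xorSum-false xs)))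
  where
  excluded : ∀ {b} → (b ≡ true → ⊥) → b ≡ false
  excluded {false} _ = refl
  excluded {true}  h = contradiction refl h

odd : ℕ → Bool
odd zero    = false
odd (suc n) = not (odd n)

%2-odd : ∀ n → n % 2 ≡ (if odd n then 1 else 0)
%2-odd zero          = refl
%2-odd (suc zero)    = refl
%2-odd (suc (suc n)) = trans (%2-odd n) (cong (if_then 1 else 0) (sym (not-not (odd n))))
  where
  not-not : ∀ b → not (not b) ≡ b
  not-not false = refl
  not-not true  = refl

odd-count : ∀ {A : Set} (P : A → Bool) xs → odd (length (filterᵇ P xs)) ≡ xorSum P xs
odd-count P []       = refl
odd-count P (x ∷ xs) with P x
... | true  = cong not (odd-count P xs)
... | false = odd-count P xs

-- Recursion on the largest allowed part

bounded-⊆ : ∀ {k m} {p : List ℕ} → k ≤ m → All (_≤ k) p → All (_≤ m) p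
bounded-⊆ k≤m = All.map (λ x≤k → ≤-trans x≤k k≤m)

partsF-bounded : ∀ f n m → All (All (_≤ m)) (partsF f n m)
partsF-bounded zero    zero    m = [] ∷ []
partsF-bounded zero    (suc n) m = []
partsF-bounded (suc f) zero    m = [] ∷ []
partsF-bounded (suc f) (suc n) m = All.concat⁺ (All.map⁺ (All.applyUpTo⁺₁ suc (suc n ⊓ m) λ {i} i<n⊓m →
  let k≤m = ≤-trans i<n⊓m (m⊓n≤n (suc n) m) in
  All.map⁺ (All.map (λ p≤ → k≤m ∷ bounded-⊆ k≤m p≤) (partsF-bounded f (n ∸ i) (suc i)))))

partsF-small : ∀ f {n m} → n ≤ m → partsF f n (suc m) ≡ partsF f n m
partsF-small zero    {zero}  n≤m = refl
partsF-small zero    {suc n} n≤m = refl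
partsF-small (suc f) {zero}  n≤m = refl
partsF-small (suc f) {suc n} {m} n≤m =
  cong (λ b → concatMap (λ k → map (k ∷_) (partsF f (suc n ∸ k) k)) (range1 b))
    (trans (m≤n⇒m⊓n≡m (m≤n⇒m≤1+n n≤m)) (sym (m≤n⇒m⊓n≡m n≤m)))

-- `partsF` recurses on the first part chosen, whereas `H` grows by one part size at a time.
-- Splitting off the partitions with largest part m + 1 aligns the two recursions.
partsF-large : ∀ f m k → partsF (suc f) (suc m + k) (suc m) ≡
               partsF (suc f) (suc m + k) m ++ map (suc m ∷_) (partsF f k (suc m))
partsF-large f m k = begin
  concatMap g (range1 ((suc m + k) ⊓ suc m))
    ≡⟨ cong (concatMap g ∘ range1) (m≥n⇒m⊓n≡n (m≤m+n (suc m) k)) ⟩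
  concatMap g (range1 (suc m))
    ≡⟨ cong (concatMap g) (applyUpTo-∷ʳ suc m) ⟨
  concatMap g (range1 m ++ suc m ∷ [])
    ≡⟨ concatMap-++ g (range1 m) (suc m ∷ []) ⟩
  concatMap g (range1 m) ++ (g (suc m) ++ [])
    ≡⟨ cong₂ _++_ (cong (concatMap g ∘ range1) (sym (m≥n⇒m⊓n≡n (≤-trans (n≤1+n m) (m≤m+n (suc m) k)))))
         (trans (++-identityʳ _) (cong (λ l → map (suc m ∷_) (partsF f l (suc m))) (m+n∸m≡n m k))) ⟩
  partsF (suc f) (suc m + k) m ++ map (suc m ∷_) (partsF f k (suc m)) ∎
  where
  open ≡-Reasoning
  g = λ l → map (l ∷_) (partsF f (suc m + k ∸ l) l)

partsF-ones : ∀ {f n} → n ≤ f → partsF f n 1 ≡ replicate n 1 ∷ []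
partsF-ones {zero}  {zero}  _         = refl
partsF-ones {suc f} {zero}  _         = refl
partsF-ones {suc f} {suc n} (s≤s n≤f) = begin
  concatMap g (range1 (suc (n ⊓ 0)))    ≡⟨ cong (concatMap g ∘ range1 ∘ suc) (⊓-zeroʳ n) ⟩
  map (1 ∷_) (partsF f n 1) ++ []       ≡⟨ cong (λ ps → map (1 ∷_) ps ++ []) (partsF-ones n≤f) ⟩
  replicate (suc n) 1 ∷ []              ∎
  where
  open ≡-Reasoning
  g = λ l → map (l ∷_) (partsF f (suc n ∸ l) l)

okOnes : ℕ → ℕ → Bool
okOnes j c = (c ≡ᵇ j * j) ∨ (c ≡ᵇ j * j + 1)

mult-here : ∀ x p → mult x (x ∷ p) ≡ suc (mult x p)
mult-here x p = cong length (filter-accept (x ≟_) refl)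

mult-there : ∀ {x y} p → x ≢ y → mult x (y ∷ p) ≡ mult x p
mult-there {x} p x≢y = cong length (filter-reject (x ≟_) x≢y)

mult-absent : ∀ {m p} → All (_≤ m) p → mult (suc m) p ≡ 0
mult-absent             []           = refl
mult-absent {m} {y ∷ p} (y≤m ∷ p≤m) = trans (mult-there p (λ e → <-irrefl (sym e) (s≤s y≤m))) (mult-absent p≤m)

all-cong : ∀ {A : Set} {P Q : A → Bool} {xs} → All (λ x → P x ≡ Q x) xs → all P xs ≡ all Q xs
all-cong []       = refl
all-cong (p ∷ ps) = cong₂ _∧_ p (all-cong ps)

-- The new part is at least 2 and exceeds every part of p, so it changes neither the multiplicity of
-- 1 nor that of any part of p, and its own condition factors out.
condJ-new : ∀ j {m p} → All (_≤ suc m) p →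
            condJ j (suc (suc m) ∷ p) ≡ okMult j 1 (suc (suc m)) ∧ condJ j p
condJ-new j {m} {p} p≤ = begin
  okOnes j (mult 1 (M ∷ p)) ∧ (okMult j (mult M (M ∷ p)) M ∧ all (λ x → okMult j (mult x (M ∷ p)) x) p)
    ≡⟨ cong₂ _∧_ (cong (okOnes j) (mult-there {1} {M} p (λ ())))
         (cong₂ _∧_ (cong (λ c → okMult j c M) (trans (mult-here M p) (cong suc (mult-absent p≤))))
           (all-cong {P = λ x → okMult j (mult x (M ∷ p)) x} {Q = λ x → okMult j (mult x p) x}
             (All.map (λ {x} x≤ → cong (λ c → okMult j c x) (mult-there p (λ e → <-irrefl e (s≤s x≤)))) p≤))) ⟩
  okOnes j (mult 1 p) ∧ (okMult j 1 M ∧ all (λ x → okMult j (mult x p) x) p)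
    ≡⟨ swap (okOnes j (mult 1 p)) (okMult j 1 M) _ ⟩
  okMult j 1 M ∧ condJ j p ∎
  where
  open ≡-Reasoning
  M = suc (suc m)
  swap : ∀ a b c → a ∧ (b ∧ c) ≡ b ∧ (a ∧ c)
  swap a b c = trans (sym (∧-assoc a b c)) (trans (cong (_∧ c) (∧-comm a b)) (∧-assoc b a c))

okMult-repeated : ∀ j c m → okMult j (suc (suc c)) (suc (suc m)) ≡ false
okMult-repeated j c m with isEven (suc (suc m))
... | true  = refl
... | false = refl

condJ-repeated : ∀ j m p → condJ j (suc (suc m) ∷ suc (suc m) ∷ p) ≡ false
condJ-repeated j m p = trans
  (cong (λ b → okOnes j (mult 1 (M ∷ M ∷ p)) ∧ (b ∧ all (λ x → okMult j (mult x (M ∷ M ∷ p)) x) (M ∷ p)))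
    (trans (cong (λ c → okMult j c M) (trans (mult-here M (M ∷ p)) (cong suc (mult-here M p)))) (okMult-repeated j (mult M p) m)))
  (∧-zeroʳ (okOnes j (mult 1 (M ∷ M ∷ p))))
  where
  M = suc (suc m)

condJ-ones : ∀ j n → condJ j (replicate n 1) ≡ okOnes j n
condJ-ones j n = trans (cong₂ _∧_ (cong (okOnes j) (count n)) (allOk (λ x → mult x (replicate n 1)) n)) (∧-identityʳ _)
  where
  count : ∀ n → mult 1 (replicate n 1) ≡ n
  count zero    = refl
  count (suc n) = trans (mult-here 1 (replicate n 1)) (cong suc (count n))
  allOk : ∀ (c : ℕ → ℕ) n → all (λ x → okMult j (c x) x) (replicate n 1) ≡ true
  allOk c zero    = refl
  allOk c (suc n) = allOk c n

G : ℕ → ℕ → Series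
G j m = q^ (j * j) ⊛ H j m

opaque
  unfolding 𝟘 q^_ _⊕_ _⊛_

  fac-⊛ : ∀ b k f n → (fac b k ⊛ f) n ≡ f n xor (b ∧ (q^ k ⊛ f) n)
  fac-⊛ false k f n = trans (⊛-distribʳ f (q^ 0) 𝟘 n) (cong₂ _xor_ (⊛-identityˡ f n) (⊛-zeroˡ f n))
  fac-⊛ true  k f n = trans (⊛-distribʳ f (q^ 0) (q^ k) n) (cong (_xor (q^ k ⊛ f) n) (⊛-identityˡ f n))

G-suc : ∀ j m n → G j (suc m) n ≡ (fac (okMult j 1 (suc m)) (suc m) ⊛ G j m) n
G-suc j m n = coeff (solve 3 (λ q h f → q :* (h :* f) := f :* (q :* h)) ≈-refl
                (q^ (j * j)) (H j m) (fac (okMult j 1 (suc m)) (suc m))) n ≤-refl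
  where
  open Truncated (suc n)
  open S using (solve; _:+_; _:*_; _:=_; con)

G-suc-small : ∀ j {m n} → n ≤ m → G j (suc m) n ≡ G j m n
G-suc-small j {m} {n} n≤m = begin
  G j (suc m) n                     ≡⟨ G-suc j m n ⟩
  (fac b (suc m) ⊛ G j m) n         ≡⟨ fac-⊛ b (suc m) (G j m) n ⟩
  G j m n xor (b ∧ (q^ suc m ⊛ G j m) n) ≡⟨ cong (λ c → G j m n xor (b ∧ c)) (q^-⊛-< (G j m) (s≤s n≤m)) ⟩
  G j m n xor (b ∧ false)           ≡⟨ cong (G j m n xor_) (∧-zeroʳ b) ⟩
  G j m n xor false                 ≡⟨ xor-identityʳ _ ⟩
  G j m n                           ∎
  where
  open ≡-Reasoning
  b = okMult j 1 (suc m)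

G-suc-large : ∀ j m k → G j (suc m) (suc m + k) ≡ G j m (suc m + k) xor (okMult j 1 (suc m) ∧ G j m k)
G-suc-large j m k = trans (G-suc j m (suc m + k)) (trans (fac-⊛ (okMult j 1 (suc m)) (suc m) (G j m) (suc m + k))
  (cong (λ c → G j m (suc m + k) xor (okMult j 1 (suc m) ∧ c)) (q^-⊛-≥ (suc m) (G j m) k)))

G-first : ∀ j n → G j 1 n ≡ (q^ (j * j) ⊕ q^ (j * j + 1)) n
G-first j n = coeff (≈-trans
  (solve 2 (λ x q → x :* (con true :* (con true :+ q)) := x :+ x :* q) ≈-refl (q^ (j * j)) (q^ 1))
  (+-congˡ (≈-sym (q^-+ (j * j) 1 refl)))) n ≤-refl
  where
  open Truncated (suc n)
  open S using (solve; _:+_; _:*_; _:=_; con)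

opaque
  unfolding _⊕_ q^_

  G-okOnes : ∀ j n → G j 1 n ≡ okOnes j n
  G-okOnes j n = trans (G-first j n) (xor≡∨ n (j * j))
    where
    xor≡∨ : ∀ n s → (s ≡ᵇ n) xor (s + 1 ≡ᵇ n) ≡ (n ≡ᵇ s) ∨ (n ≡ᵇ s + 1)
    xor≡∨ zero          zero    = refl
    xor≡∨ zero          (suc s) = refl
    xor≡∨ (suc zero)    zero    = refl
    xor≡∨ (suc (suc n)) zero    = refl
    xor≡∨ (suc n)       (suc s) = xor≡∨ n s

-- Partitions of k that already contain m + 2 would repeat a part greater than 1 and are rejected,
-- so only those with parts at most m + 1 count.
count-repeated : ∀ j {f k} m → k ≤ f →
  xorSum (λ p → condJ j (suc (suc m) ∷ p)) (partsF f k (suc (suc m)))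
    ≡ okMult j 1 (suc (suc m)) ∧ xorSum (condJ j) (partsF f k (suc m))
count-repeated j {f} {k} m k≤f with ≤-<-connex k (suc m)
... | inj₁ k≤ = trans (cong (xorSum _) (partsF-small f k≤)) (without f k)
  where
  without : ∀ f k → xorSum (λ p → condJ j (suc (suc m) ∷ p)) (partsF f k (suc m))
    ≡ okMult j 1 (suc (suc m)) ∧ xorSum (condJ j) (partsF f k (suc m))
  without f k = trans (xorSum-cong (All.map (condJ-new j) (partsF-bounded f k (suc m))))
                  (xorSum-∧ (okMult j 1 (suc (suc m))) (condJ j) (partsF f k (suc m)))
count-repeated j {zero}  m z≤n | inj₂ ()
count-repeated j {suc f} {k} m k≤f | inj₂ M≤k = go (k ∸ M) (m+[n∸m]≡n M≤k)
  where
  open ≡-Reasoning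
  M = suc (suc m)
  go : ∀ l → M + l ≡ k → xorSum (λ p → condJ j (M ∷ p)) (partsF (suc f) k M)
         ≡ okMult j 1 M ∧ xorSum (condJ j) (partsF (suc f) k (suc m))
  go l refl = begin
    xorSum (λ p → condJ j (M ∷ p)) (partsF (suc f) (M + l) M)
      ≡⟨ cong (xorSum _) (partsF-large f (suc m) l) ⟩
    xorSum (λ p → condJ j (M ∷ p)) (partsF (suc f) (M + l) (suc m) ++ map (M ∷_) (partsF f l M))
      ≡⟨ xorSum-++ _ (partsF (suc f) (M + l) (suc m)) _ ⟩
    xorSum (λ p → condJ j (M ∷ p)) (partsF (suc f) (M + l) (suc m)) xor
      xorSum (λ p → condJ j (M ∷ p)) (map (M ∷_) (partsF f l M))
      ≡⟨ cong₂ _xor_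
           (trans (xorSum-cong (All.map (condJ-new j) (partsF-bounded (suc f) (M + l) (suc m))))
                  (xorSum-∧ (okMult j 1 M) (condJ j) (partsF (suc f) (M + l) (suc m))))
           (trans (xorSum-map _ (M ∷_) (partsF f l M))
             (trans (xorSum-cong (All.universal (condJ-repeated j m) (partsF f l M))) (xorSum-false (partsF f l M)))) ⟩
    (okMult j 1 M ∧ xorSum (condJ j) (partsF (suc f) (M + l) (suc m))) xor false
      ≡⟨ xor-identityʳ _ ⟩
    okMult j 1 M ∧ xorSum (condJ j) (partsF (suc f) (M + l) (suc m)) ∎

-- Both sides obey the same recursion in the largest allowed part: nothing changes if it exceeds n,
-- and otherwise it is absent or used once. The base case has ones only, with multiplicity j² or j²
-- + 1.
count-condJ : ∀ j m {f n} → n ≤ f → xorSum (condJ j) (partsF f n (suc m)) ≡ G j (suc m) n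
count-condJ j zero    {f} {n} n≤f = begin
  xorSum (condJ j) (partsF f n 1)        ≡⟨ cong (xorSum (condJ j)) (partsF-ones n≤f) ⟩
  condJ j (replicate n 1) xor false      ≡⟨ xor-identityʳ _ ⟩
  condJ j (replicate n 1)                ≡⟨ condJ-ones j n ⟩
  okOnes j n                             ≡⟨ G-okOnes j n ⟨
  G j 1 n                                ∎
  where open ≡-Reasoning
count-condJ j (suc m) {f} {n} n≤f with ≤-<-connex n (suc m)
... | inj₁ n≤ = trans (cong (xorSum (condJ j)) (partsF-small f n≤))
                  (trans (count-condJ j m n≤f) (sym (G-suc-small j n≤)))
count-condJ j (suc m) {zero}  z≤n     | inj₂ ()
count-condJ j (suc m) {suc f} {n} n≤f | inj₂ M≤n = go (n ∸ M) (m+[n∸m]≡n M≤n)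
  where
  open ≡-Reasoning
  M = suc (suc m)
  go : ∀ k → M + k ≡ n → xorSum (condJ j) (partsF (suc f) n M) ≡ G j M n
  go k refl = begin
    xorSum (condJ j) (partsF (suc f) (M + k) M)
      ≡⟨ cong (xorSum (condJ j)) (partsF-large f (suc m) k) ⟩
    xorSum (condJ j) (partsF (suc f) (M + k) (suc m) ++ map (M ∷_) (partsF f k M))
      ≡⟨ xorSum-++ (condJ j) (partsF (suc f) (M + k) (suc m)) _ ⟩
    xorSum (condJ j) (partsF (suc f) (M + k) (suc m)) xor xorSum (condJ j) (map (M ∷_) (partsF f k M))
      ≡⟨ cong₂ _xor_ (count-condJ j m n≤f) (trans (xorSum-map (condJ j) (M ∷_) (partsF f k M)) (count-repeated j m k≤f)) ⟩
    G j (suc m) (M + k) xor (okMult j 1 M ∧ xorSum (condJ j) (partsF f k (suc m)))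
      ≡⟨ cong (λ b → G j (suc m) (M + k) xor (okMult j 1 M ∧ b)) (count-condJ j m k≤f) ⟩
    G j (suc m) (M + k) xor (okMult j 1 M ∧ G j (suc m) k)
      ≡⟨ G-suc-large j (suc m) k ⟨
    G j M (M + k) ∎
    where
    k≤f : k ≤ f
    k≤f = ≤-trans (m≤n+m k (suc m)) (s≤s⁻¹ n≤f)

okOnes-bounds : ∀ {j c} → okOnes j c ≡ true → j * j ≤ c × c ≤ j * j + 1
okOnes-bounds {j} {c} h with c ≡ᵇ j * j in e₁ | c ≡ᵇ j * j + 1 in e₂
... | true  | _    = ≤-reflexive (sym c≡) , ≤-trans (≤-reflexive c≡) (m≤m+n _ 1)
  where c≡ = ≡ᵇ⇒≡ c (j * j) (subst T (sym e₁) _)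
... | false | true = ≤-trans (m≤m+n _ 1) (≤-reflexive (sym c≡)) , ≤-reflexive c≡
  where c≡ = ≡ᵇ⇒≡ c (j * j + 1) (subst T (sym e₂) _)

-- The gap (j+1)² > j² + 1 requires j ≥ 1, hence the successors: for 0 and 1 the ranges {0, 1} and
-- {1, 2} would overlap.
condJ-exclusive : ∀ {i j} p → i < j → condJ (suc i) p ≡ true → condJ (suc j) p ≡ true → ⊥
condJ-exclusive {i} {j} p i<j hi hj = <-irrefl refl (begin-strict
  mult 1 p                        ≤⟨ proj₂ (okOnes-bounds {suc i} (∧-true hi)) ⟩
  suc i * suc i + 1               <⟨ n<1+n _ ⟩
  suc (suc i * suc i + 1)         ≤⟨ m≤m+n _ (suc (i + i)) ⟩
  suc (suc i * suc i + 1) + suc (i + i) ≡⟨ eq i ⟩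
  suc (suc i) * suc (suc i)       ≤⟨ *-mono-≤ (s≤s i<j) (s≤s i<j) ⟩
  suc j * suc j                   ≤⟨ proj₁ (okOnes-bounds {suc j} (∧-true hj)) ⟩
  mult 1 p                        ∎)
  where
  open ≤-Reasoning
  ∧-true : ∀ {a b} → a ∧ b ≡ true → a ≡ true
  ∧-true {true} _ = refl
  eq : ∀ i → suc (suc i * suc i + 1) + suc (i + i) ≡ suc (suc i) * suc (suc i)
  eq = solve-∀

opaque
  unfolding 𝟘 _⊕_

  ∑-coeff : ∀ f m n → ∑ f m n ≡ xorSum (λ j → f (j ∸ 1) n) (range1 m)
  ∑-coeff f zero    n = refl
  ∑-coeff f (suc m) n = begin
    ∑ f m n xor f m n                            ≡⟨ cong₂ _xor_ (∑-coeff f m n) (sym (xor-identityʳ _)) ⟩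
    xorSum F (range1 m) xor xorSum F (suc m ∷ []) ≡⟨ xorSum-++ F (range1 m) _ ⟨
    xorSum F (range1 m ++ suc m ∷ [])            ≡⟨ cong (xorSum F) (applyUpTo-∷ʳ suc m) ⟩
    xorSum F (range1 (suc m))                    ∎
    where
    open ≡-Reasoning
    F : ℕ → Bool
    F = λ j → f (j ∸ 1) n

odd-c3 : ∀ n → odd (c3 (suc n)) ≡ ∑ (λ i → G (suc i) (suc n)) (suc n) (suc n)
odd-c3 n = begin
  odd (c3 N)                                                ≡⟨ odd-count (isC3 N) (partitions N) ⟩
  xorSum (isC3 N) (partitions N)
    ≡⟨ xorSum-cong (All.universal (λ p → any≡xorSum (AllPairs.applyUpTo⁺₁ suc N
          λ {i} {j} i<j _ → condJ-exclusive {i} {j} p i<j)) (partitions N)) ⟩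
  xorSum (λ p → xorSum (λ j → condJ j p) (range1 N)) (partitions N)
    ≡⟨ xorSum-swap condJ (range1 N) (partitions N) ⟩
  xorSum (λ j → xorSum (condJ j) (partitions N)) (range1 N)
    ≡⟨ xorSum-cong {P = λ j → xorSum (condJ j) (partitions N)} {Q = λ j → G (suc (j ∸ 1)) N N}
          (All.applyUpTo⁺₂ suc N (λ i → count-condJ (suc i) n {N} {N} ≤-refl)) ⟩
  xorSum (λ j → G (suc (j ∸ 1)) N N) (range1 N)             ≡⟨ ∑-coeff (λ i → G (suc i) N) N N ⟨
  ∑ (λ i → G (suc i) N) N N                                 ∎
  where
  open ≡-Reasoning
  N = suc n

-- Coefficients of the pentagonal and triangular series

Reflects-map : ∀ {P Q : Set} {b} → (P → Q) → (Q → P) → Reflects P b → Reflects Q b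
Reflects-map f g (ofʸ p)  = ofʸ (f p)
Reflects-map f g (ofⁿ ¬p) = ofⁿ (¬p ∘ g)

Reflects-xor : ∀ {P Q : Set} {a b} → (P → Q → ⊥) → Reflects P a → Reflects Q b → Reflects (P ⊎ Q) (a xor b)
Reflects-xor P#Q (ofʸ p)  (ofʸ q)  = contradiction q (P#Q p)
Reflects-xor P#Q (ofʸ p)  (ofⁿ _)  = ofʸ (inj₁ p)
Reflects-xor P#Q (ofⁿ _)  (ofʸ q)  = ofʸ (inj₂ q)
Reflects-xor P#Q (ofⁿ ¬p) (ofⁿ ¬q) = ofⁿ λ { (inj₁ p) → ¬p p ; (inj₂ q) → ¬q q }

Increasing : (ℕ → ℕ) → Set
Increasing g = ∀ s → g s < g (suc s)

increasing-< : ∀ {g} → Increasing g → ∀ {s t} → s < t → g s < g t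
increasing-< inc {s} {suc t} (s≤s s≤t) with m≤n⇒m<n∨m≡n s≤t
... | inj₁ s<t  = <-trans (increasing-< inc s<t) (inc t)
... | inj₂ refl = inc s

increasing-≥ : ∀ {g} → Increasing g → ∀ s → s ≤ g s
increasing-≥ inc zero    = z≤n
increasing-≥ inc (suc s) = ≤-<-trans (increasing-≥ inc s) (inc s)

opaque
  unfolding 𝟘 q^_ _⊕_

  -- Strict monotonicity makes the exponents distinct, so no two powers cancel modulo 2.
  ∑-reflects-below : ∀ {g} → Increasing g → ∀ n K →
    Reflects (∃[ s ] (s < K × g s ≡ n)) (∑ (λ s → q^ (g s)) K n)
  ∑-reflects-below     inc n zero    = ofⁿ λ { (_ , () , _) }
  ∑-reflects-below {g} inc n (suc K) = Reflects-map join split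
    (Reflects-xor (λ { (s , s<K , gs≡n) gK≡n → <-irrefl (trans gs≡n (sym gK≡n)) (increasing-< inc s<K) })
      (∑-reflects-below inc n K) (proof (g K ≟ n)))
    where
    join : (∃[ s ] (s < K × g s ≡ n)) ⊎ g K ≡ n → ∃[ s ] (s < suc K × g s ≡ n)
    join (inj₁ (s , s<K , e)) = s , m<n⇒m<1+n s<K , e
    join (inj₂ e)             = K , ≤-refl , e
    split : ∃[ s ] (s < suc K × g s ≡ n) → (∃[ s ] (s < K × g s ≡ n)) ⊎ g K ≡ n
    split (s , s≤s s≤K , e) with m≤n⇒m<n∨m≡n s≤K
    ... | inj₁ s<K  = inj₁ (s , s<K , e)
    ... | inj₂ refl = inj₂ e

∑-reflects : ∀ {g} → Increasing g → ∀ {n K} → n < K →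
  Reflects (∃[ s ] (g s ≡ n)) (∑ (λ s → q^ (g s)) K n)
∑-reflects inc {n} {K} n<K = Reflects-map (λ { (s , _ , e) → s , e })
  (λ { (s , e) → s , ≤-<-trans (≤-trans (increasing-≥ inc s) (≤-reflexive e)) n<K , e })
  (∑-reflects-below inc n K)

opaque
  unfolding _⊕_

  ⊕-reflects : ∀ {P Q : Set} {f g : Series} {n} → (P → Q → ⊥) → Reflects P (f n) → Reflects Q (g n) →
               Reflects (P ⊎ Q) ((f ⊕ g) n)
  ⊕-reflects = Reflects-xor

pentℤ : ℤ → ℕ
pentℤ (+ s)    = s * (3 * s + 1)
pentℤ -[1+ s ] = suc s * (3 * s + 2)

pentℤ-formula : ∀ m → + pentℤ m ≡ m *ℤ (+ 3 *ℤ m +ℤ + 1)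
pentℤ-formula (+ s)    = trans (ℤ.pos-* s _) (cong (+ s *ℤ_) (cong (_+ℤ + 1) (ℤ.pos-* 3 s)))
pentℤ-formula -[1+ s ] = trans (trans (ℤ.pos-* (suc s) _) (cong (+ suc s *ℤ_) (cong (_+ℤ + 2) (ℤ.pos-* 3 s)))) (eq (+ s))
  where
  eq : ∀ x → (+ 1 +ℤ x) *ℤ (+ 3 *ℤ x +ℤ + 2) ≡ (- (+ 1 +ℤ x)) *ℤ (+ 3 *ℤ (- (+ 1 +ℤ x)) +ℤ + 1)
  eq = ℤ.solve-∀

-- The two branches interleave: 0 < 2 < 4 < 10 < 14 < ... Writing the larger index as the smaller
-- plus d, the difference of the values is 1 plus a polynomial with non-negative coefficients.
pos-neg-disjoint : ∀ s t → pentℤ (+ s) ≢ pentℤ -[1+ t ]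
pos-neg-disjoint s t e with <-≤-connex t s
... | inj₁ t<s = m≢1+m+n (pentℤ -[1+ t ]) (trans (sym e) (trans (cong (λ u → u * (3 * u + 1)) (sym (m+[n∸m]≡n t<s)))
    (eq t (s ∸ suc t))))
  where
  eq : ∀ t d → (suc t + d) * (3 * (suc t + d) + 1) ≡ suc (suc t * (3 * t + 2)
         + (1 + 2 * t + suc t * (3 * d) + d * (3 * t + 4 + 3 * d)))
  eq = solve-∀
... | inj₂ s≤t = m≢1+m+n (pentℤ (+ s)) (trans e (trans (cong (λ u → suc u * (3 * u + 2)) (sym (m+[n∸m]≡n s≤t))) (eq s (t ∸ s))))
  where
  eq : ∀ s d → suc (s + d) * (3 * (s + d) + 2) ≡ suc (s * (3 * s + 1)
         + (s * (3 * d + 1) + 3 * s + 3 * d + 1 + d * (3 * s + 3 * d + 2)))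
  eq = solve-∀

2*tri : ∀ s → 2 * tri s ≡ s * (s + 1)
2*tri zero    = refl
2*tri (suc s) = trans (*-distribˡ-+ 2 (tri s) (suc s)) (trans (cong (_+ 2 * suc s) (2*tri s)) (eq s))
  where
  eq : ∀ s → s * (s + 1) + 2 * suc s ≡ suc s * (suc s + 1)
  eq = solve-∀

tri-increasing : Increasing tri
tri-increasing s = m<m+n (tri s) (s≤s z≤n)

posExp-increasing : Increasing posExp
posExp-increasing s = *-monoʳ-< 2 (+-mono-<-≤ (*-mono-< (n<1+n s) (n<1+n s)) (<⇒≤ (tri-increasing s)))

negExp-increasing : Increasing negExp
negExp-increasing s = *-monoʳ-< 2 (+-mono-<-≤ (*-mono-< (n<1+n (suc s)) (n<1+n (suc s))) (<⇒≤ (tri-increasing s)))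

posExp≡ : ∀ s → posExp s ≡ pentℤ (+ s)
posExp≡ s = trans (*-distribˡ-+ 2 (s * s) (tri s)) (trans (cong (λ t → 2 * (s * s) + t) (2*tri s)) (eq s))
  where
  eq : ∀ s → 2 * (s * s) + s * (s + 1) ≡ s * (3 * s + 1)
  eq = solve-∀

negExp≡ : ∀ s → negExp s ≡ pentℤ -[1+ s ]
negExp≡ s = trans (*-distribˡ-+ 2 (suc s * suc s) (tri s)) (trans (cong (λ t → 2 * (suc s * suc s) + t) (2*tri s)) (eq s))
  where
  eq : ∀ s → 2 * (suc s * suc s) + s * (s + 1) ≡ suc s * (3 * s + 2)
  eq = solve-∀

pentagonal-reflects : ∀ n {K} → n < K → Reflects (∃[ m ] (pentℤ m ≡ n)) (Truncated.Pentagonal.pent (suc n) K n)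
pentagonal-reflects n {K} n<K = subst (Reflects _) (sym (Truncated.coeff (Truncated.pent-split (suc n) K) n ≤-refl))
  (Reflects-map join split (⊕-reflects {f = ∑ (λ s → q^ (negExp s)) K} {g = ∑ (λ s → q^ (posExp s)) (suc K)} disjoint
    (∑-reflects negExp-increasing n<K) (∑-reflects posExp-increasing (m<n⇒m<1+n n<K))))
  where
  disjoint : ∃[ t ] (negExp t ≡ n) → ∃[ s ] (posExp s ≡ n) → ⊥
  disjoint (t , e) (s , e′) = pos-neg-disjoint s t (trans (sym (posExp≡ s)) (trans e′ (trans (sym e) (negExp≡ t))))
  join : (∃[ s ] (negExp s ≡ n)) ⊎ (∃[ s ] (posExp s ≡ n)) → ∃[ m ] (pentℤ m ≡ n)
  join (inj₁ (s , e)) = -[1+ s ] , trans (sym (negExp≡ s)) e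
  join (inj₂ (s , e)) = + s , trans (sym (posExp≡ s)) e
  split : ∃[ m ] (pentℤ m ≡ n) → (∃[ s ] (negExp s ≡ n)) ⊎ (∃[ s ] (posExp s ≡ n))
  split (+ s , e)      = inj₂ (s , trans (posExp≡ s) e)
  split (-[1+ s ] , e) = inj₁ (s , trans (negExp≡ s) e)

opaque
  unfolding _⊕_

  -- The two bits stay separate because both may be 1, as at n = 10, and then they cancel. Each
  -- later use first rules out one of the two representations.
  c3-parity : ∀ n → 1 ≤ n → ∃[ a ] ∃[ b ]
    (odd (c3 n) ≡ a xor b × Reflects (∃[ m ] (pentℤ m ≡ n)) a × Reflects (∃[ k ] (tri k ≡ n)) b)
  c3-parity (suc n) _ = _ , _
    , trans (odd-c3 n) (Truncated.coeff (Truncated.generating (suc (suc n)) (suc n) ≤-refl) (suc n) ≤-refl)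
    , pentagonal-reflects (suc n) ≤-refl
    , ∑-reflects tri-increasing (m≤m+n (suc (suc n)) _)

odd⇔%2 : ∀ n → (n % 2 ≡ 1) ⇔ (odd n ≡ true)
odd⇔%2 n with odd n | %2-odd n
... | true  | e = mk⇔ (λ _ → refl) (λ _ → e)
... | false | e = mk⇔ (λ e′ → contradiction (trans (sym e) e′) λ ()) (λ ())

c3-odd⇔tri : ∀ n → 1 ≤ n → (∀ m → pentℤ m ≢ n) → (c3 n % 2 ≡ 1) ⇔ (∃[ k ] (tri k ≡ n))
c3-odd⇔tri n 1≤n ¬pent with c3-parity n 1≤n | odd⇔%2 (c3 n)
... | _ , _ , _ , ofʸ (m , e) , _      | _  = contradiction e (¬pent m)
... | _ , _ , p , ofⁿ _       , ofʸ t  | o = mk⇔ (λ _ → t) (λ _ → Equivalence.from o p)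
... | _ , _ , p , ofⁿ _       , ofⁿ ¬t | o = mk⇔ (λ h → contradiction (trans (sym p) (Equivalence.to o h)) λ ()) (λ t → contradiction t ¬t)

c3-odd⇔pent : ∀ n → 1 ≤ n → (∀ k → tri k ≢ n) → (c3 n % 2 ≡ 1) ⇔ (∃[ m ] (pentℤ m ≡ n))
c3-odd⇔pent n 1≤n ¬tri with c3-parity n 1≤n | odd⇔%2 (c3 n)
... | _ , _ , _ , _      , ofʸ (k , e) | _ = contradiction e (¬tri k)
... | _ , _ , p , ofʸ t  , ofⁿ _       | o = mk⇔ (λ _ → t) (λ _ → Equivalence.from o p)
... | _ , _ , p , ofⁿ ¬t , ofⁿ _       | o = mk⇔ (λ h → contradiction (trans (sym p) (Equivalence.to o h)) λ ()) (λ t → contradiction t ¬t)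

-- Exponents modulo 5

[5n+c]%5 : ∀ n c → (5 * n + c) % 5 ≡ c % 5
[5n+c]%5 n c = trans (cong (_% 5) (trans (ℕ.+-comm (5 * n) c) (cong (λ t → c + t) (ℕ.*-comm 5 n)))) ([m+kn]%n≡m%n c n 5)

-- Matching on a residue turns congruence hypotheses into closed equations that computation decides.
data Residue : ℕ → Set where
  r0 : Residue 0
  r1 : Residue 1
  r2 : Residue 2
  r3 : Residue 3
  r4 : Residue 4

residue : ∀ k → Residue (k % 5)
residue k = below (m%n<n k 5)
  where
  below : ∀ {r} → r < 5 → Residue r
  below {0} _ = r0
  below {1} _ = r1
  below {2} _ = r2
  below {3} _ = r3
  below {4} _ = r4
  below {suc (suc (suc (suc (suc r))))} (s≤s (s≤s (s≤s (s≤s (s≤s ())))))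

-- Doubling avoids the division in k(k+1)/2 and loses nothing, as 2 is invertible modulo 5.
tri%5 : ∀ k → 2 * tri k % 5 ≡ k % 5 * (k % 5 + 1) % 5
tri%5 k = trans (cong (_% 5) (trans (2*tri k) (trans (cong (λ u → u * (u + 1)) (m≡m%n+[m/n]*n k 5)) (eq (k % 5) (k / 5)))))
  ([m+kn]%n≡m%n (k % 5 * (k % 5 + 1)) (k / 5 * (k % 5 + k % 5 + 1 + k / 5 * 5)) 5)
  where
  eq : ∀ r q → (r + q * 5) * (r + q * 5 + 1) ≡ r * (r + 1) + (q * (r + r + 1 + q * 5)) * 5
  eq = solve-∀

-- -(1 + r + 5q) = (4 - r) - 5(q + 1).
neg%5 : ∀ {r} q → Residue r → -[1+ r + q * 5 ] %ℕ 5 ≡ 4 ∸ r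
neg%5 q r0 rewrite [m+kn]%n≡m%n 1 q 5 {{_}} = refl
neg%5 q r1 rewrite [m+kn]%n≡m%n 2 q 5 {{_}} = refl
neg%5 q r2 rewrite [m+kn]%n≡m%n 3 q 5 {{_}} = refl
neg%5 q r3 rewrite [m+kn]%n≡m%n 4 q 5 {{_}} = refl
neg%5 q r4 rewrite [m+kn]%n≡m%n 5 q 5 {{_}} = refl

pentℤ%5 : ∀ m → pentℤ m % 5 ≡ m %ℕ 5 * (3 * (m %ℕ 5) + 1) % 5
pentℤ%5 (+ s) = trans (cong (_% 5) (trans (cong (λ u → u * (3 * u + 1)) (m≡m%n+[m/n]*n s 5)) (eq (s % 5) (s / 5))))
  ([m+kn]%n≡m%n (s % 5 * (3 * (s % 5) + 1)) (s / 5 * (6 * (s % 5) + 1 + 3 * (s / 5 * 5))) 5)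
  where
  eq : ∀ r q → (r + q * 5) * (3 * (r + q * 5) + 1) ≡ r * (3 * r + 1) + (q * (6 * r + 1 + 3 * (q * 5))) * 5
  eq = solve-∀
pentℤ%5 -[1+ s ] = subst (λ u → pentℤ -[1+ u ] % 5 ≡ -[1+ u ] %ℕ 5 * (3 * (-[1+ u ] %ℕ 5) + 1) % 5) (sym (m≡m%n+[m/n]*n s 5))
  (trans (trans (cong (_% 5) (eq (s % 5) (s / 5))) ([m+kn]%n≡m%n (suc (s % 5) * (3 * (s % 5) + 2)) (s / 5 * (6 * (s % 5) + 5 + 3 * (s / 5 * 5))) 5))
    (trans (table (residue s)) (cong (λ ρ → ρ * (3 * ρ + 1) % 5) (sym (neg%5 (s / 5) (residue s))))))
  where
  eq : ∀ r q → suc (r + q * 5) * (3 * (r + q * 5) + 2) ≡ suc r * (3 * r + 2) + (q * (6 * r + 5 + 3 * (q * 5))) * 5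
  eq = solve-∀
  table : ∀ {r} → Residue r → suc r * (3 * r + 2) % 5 ≡ (4 ∸ r) * (3 * (4 ∸ r) + 1) % 5
  table r0 = refl
  table r1 = refl
  table r2 = refl
  table r3 = refl
  table r4 = refl

residueℤ : ∀ m → Residue (m %ℕ 5)
residueℤ (+ s)    = residue s
residueℤ -[1+ s ] = subst (λ u → Residue (-[1+ u ] %ℕ 5)) (sym (m≡m%n+[m/n]*n s 5))
  (subst Residue (sym (neg%5 (s / 5) (residue s))) (opposite (residue s)))
  where
  opposite : ∀ {r} → Residue r → Residue (4 ∸ r)
  opposite r0 = r4
  opposite r1 = r3
  opposite r2 = r2
  opposite r3 = r1
  opposite r4 = r0

pentℤ-residue : ∀ m n c → pentℤ m ≡ 5 * n + c → m %ℕ 5 * (3 * (m %ℕ 5) + 1) % 5 ≡ c % 5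
pentℤ-residue m n c e = trans (sym (pentℤ%5 m)) (trans (cong (_% 5) e) ([5n+c]%5 n c))

tri-residue : ∀ k n c → tri k ≡ 5 * n + c → k % 5 * (k % 5 + 1) % 5 ≡ 2 * c % 5
tri-residue k n c e = trans (sym (tri%5 k)) (trans (cong (λ u → 2 * u % 5) e) (trans (cong (_% 5) (eq n c)) ([5n+c]%5 (2 * n) (2 * c))))
  where
  eq : ∀ n c → 2 * (5 * n + c) ≡ 5 * (2 * n) + 2 * c
  eq = solve-∀

2*5n+c : ∀ n c → 2 * (5 * n + c) ≡ 10 * n + 2 * c
2*5n+c = solve-∀

tri-value : ∀ k n c → tri k ≡ 5 * n + c → 10 * n + 2 * c ≡ k * (k + 1)
tri-value k n c e = trans (sym (2*5n+c n c)) (trans (cong (2 *_) (sym e)) (2*tri k))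

tri-value⁻¹ : ∀ k n c → 10 * n + 2 * c ≡ k * (k + 1) → tri k ≡ 5 * n + c
tri-value⁻¹ k n c e = *-cancelˡ-≡ _ _ 2 (trans (2*tri k) (trans (sym e) (sym (2*5n+c n c))))

pos-5n+c : ∀ n c → + (5 * n + c) ≡ + 5 *ℤ + n +ℤ + c
pos-5n+c n c = cong (_+ℤ + c) (ℤ.pos-* 5 n)

pentℤ-value : ∀ m n c → pentℤ m ≡ 5 * n + c → + 5 *ℤ + n +ℤ + c ≡ m *ℤ (+ 3 *ℤ m +ℤ + 1)
pentℤ-value m n c e = trans (sym (pos-5n+c n c)) (trans (cong +_ (sym e)) (pentℤ-formula m))

pentℤ-value⁻¹ : ∀ m n c → + 5 *ℤ + n +ℤ + c ≡ m *ℤ (+ 3 *ℤ m +ℤ + 1) → pentℤ m ≡ 5 * n + c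
pentℤ-value⁻¹ m n c e = ℤ.+-injective (trans (pentℤ-formula m) (trans (sym e) (sym (pos-5n+c n c))))

positive : ∀ n c → 1 ≤ 5 * n + suc c
positive n c = ≤-trans (s≤s z≤n) (m≤n+m (suc c) (5 * n))

tri-5n+1 : ∀ n → (∃[ k ] (tri k ≡ 5 * n + 1)) ⇔
  (∃[ j ] (j ≥ 1 × (j % 5 ≡ 1 ⊎ j % 5 ≡ 3) × 10 * n + 2 ≡ j * (j + 1)))
tri-5n+1 n = mk⇔
  (λ { (k , e) → let r = classify (residue k) (tri-residue k n 1 e) in k , nonzero k r , r , tri-value k n 1 e })
  (λ { (j , _ , _ , e) → j , tri-value⁻¹ j n 1 e })
  where
  classify : ∀ {r} → Residue r → r * (r + 1) % 5 ≡ 2 → r ≡ 1 ⊎ r ≡ 3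
  classify r1 _ = inj₁ refl
  classify r3 _ = inj₂ refl
  nonzero : ∀ k → k % 5 ≡ 1 ⊎ k % 5 ≡ 3 → k ≥ 1
  nonzero zero    (inj₁ ())
  nonzero zero    (inj₂ ())
  nonzero (suc k) _ = s≤s z≤n

tri-5n+3 : ∀ n → (∃[ k ] (tri k ≡ 5 * n + 3)) ⇔ (∃[ j ] (10 * n + 6 ≡ (5 * j + 2) * (5 * j + 3)))
tri-5n+3 n = mk⇔
  (λ { (k , e) → k / 5 , trans (tri-value k n 3 e) (trans
         (cong (λ u → u * (u + 1)) (decompose k (classify (residue k) (tri-residue k n 3 e)))) (eq (k / 5))) })
  (λ { (j , e) → 5 * j + 2 , tri-value⁻¹ (5 * j + 2) n 3 (trans e (sym (eq j))) })
  where
  classify : ∀ {r} → Residue r → r * (r + 1) % 5 ≡ 1 → r ≡ 2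
  classify r2 _ = refl
  decompose : ∀ k → k % 5 ≡ 2 → k ≡ 5 * (k / 5) + 2
  decompose k r≡2 = trans (m≡m%n+[m/n]*n k 5) (trans (cong (_+ k / 5 * 5) r≡2) (comm (k / 5)))
    where
    comm : ∀ q → 2 + q * 5 ≡ 5 * q + 2
    comm = solve-∀
  eq : ∀ j → (5 * j + 2) * (5 * j + 2 + 1) ≡ (5 * j + 2) * (5 * j + 3)
  eq j = cong ((5 * j + 2) *_) (ℕ.+-assoc (5 * j) 2 1)

pentℤ-5n+2 : ∀ n → (∃[ m ] (pentℤ m ≡ 5 * n + 2)) ⇔
  (∃[ j ] (+ 5 *ℤ + n +ℤ + 2 ≡ (+ 5 *ℤ j +ℤ + 4) *ℤ (+ 15 *ℤ j +ℤ + 13)))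
pentℤ-5n+2 n = mk⇔
  (λ { (m , e) → m /ℕ 5 , trans (pentℤ-value m n 2 e) (trans
         (cong (λ u → u *ℤ (+ 3 *ℤ u +ℤ + 1)) (decompose m (classify (residueℤ m) (pentℤ-residue m n 2 e))))
         (eq (m /ℕ 5))) })
  (λ { (j , e) → + 5 *ℤ j +ℤ + 4 , pentℤ-value⁻¹ (+ 5 *ℤ j +ℤ + 4) n 2 (trans e (sym (eq j))) })
  where
  classify : ∀ {r} → Residue r → r * (3 * r + 1) % 5 ≡ 2 → r ≡ 4
  classify r4 _ = refl
  decompose : ∀ m → m %ℕ 5 ≡ 4 → m ≡ + 5 *ℤ (m /ℕ 5) +ℤ + 4
  decompose m r≡4 = trans (ℤ.a≡a%ℕn+[a/ℕn]*n m 5) (trans (cong (λ r → + r +ℤ m /ℕ 5 *ℤ + 5) r≡4) (comm (m /ℕ 5)))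
    where
    comm : ∀ q → + 4 +ℤ q *ℤ + 5 ≡ + 5 *ℤ q +ℤ + 4
    comm = ℤ.solve-∀
  eq : ∀ j → (+ 5 *ℤ j +ℤ + 4) *ℤ (+ 3 *ℤ (+ 5 *ℤ j +ℤ + 4) +ℤ + 1) ≡ (+ 5 *ℤ j +ℤ + 4) *ℤ (+ 15 *ℤ j +ℤ + 13)
  eq j = cong ((+ 5 *ℤ j +ℤ + 4) *ℤ_) (factor j)
    where
    factor : ∀ j → + 3 *ℤ (+ 5 *ℤ j +ℤ + 4) +ℤ + 1 ≡ + 15 *ℤ j +ℤ + 13
    factor = ℤ.solve-∀

pentℤ-5n+4 : ∀ n → (∃[ m ] (pentℤ m ≡ 5 * n + 4)) ⇔
  (∃[ j ] ((j %ℕ 5 ≡ 1 ⊎ j %ℕ 5 ≡ 2) × + 5 *ℤ + n +ℤ + 4 ≡ j *ℤ (+ 3 *ℤ j +ℤ + 1)))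
pentℤ-5n+4 n = mk⇔
  (λ { (m , e) → m , classify (residueℤ m) (pentℤ-residue m n 4 e) , pentℤ-value m n 4 e })
  (λ { (j , _ , e) → j , pentℤ-value⁻¹ j n 4 e })
  where
  classify : ∀ {r} → Residue r → r * (3 * r + 1) % 5 ≡ 4 → r ≡ 1 ⊎ r ≡ 2
  classify r1 _ = inj₁ refl
  classify r2 _ = inj₂ refl

tri-≢ : ∀ c → (∀ {r} → Residue r → r * (r + 1) % 5 ≢ 2 * c % 5) → ∀ n k → tri k ≢ 5 * n + c
tri-≢ c ≢c n k e = ≢c (residue k) (tri-residue k n c e)

pentℤ-≢ : ∀ c → (∀ {r} → Residue r → r * (3 * r + 1) % 5 ≢ c % 5) → ∀ n m → pentℤ m ≢ 5 * n + c
pentℤ-≢ c ≢c n m e = ≢c (residueℤ m) (pentℤ-residue m n c e)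

theorem3 : (∀ (n : ℕ) → (c3 (5 * n + 1) % 2 ≡ 1) ⇔
    (∃[ j ] (j ≥ 1 × (j % 5 ≡ 1 ⊎ j % 5 ≡ 3) × 10 * n + 2 ≡ j * (j + 1))))
    × (∀ (n : ℕ) → (c3 (5 * n + 2) % 2 ≡ 1) ⇔
    (∃[ j ] (+ 5 *ℤ + n +ℤ + 2 ≡ (+ 5 *ℤ j +ℤ + 4) *ℤ (+ 15 *ℤ j +ℤ + 13))))
    × (∀ (n : ℕ) → (c3 (5 * n + 3) % 2 ≡ 1) ⇔
    (∃[ j ] (10 * n + 6 ≡ (5 * j + 2) * (5 * j + 3))))
    × (∀ (n : ℕ) → (c3 (5 * n + 4) % 2 ≡ 1) ⇔
    (∃[ j ] ((j %ℕ 5 ≡ 1 ⊎ j %ℕ 5 ≡ 2) × + 5 *ℤ + n +ℤ + 4 ≡ j *ℤ (+ 3 *ℤ j +ℤ + 1))))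
theorem3 =
    (λ n → ⇔-trans
        (c3-odd⇔tri (5 * n + 1) (positive n 0) (pentℤ-≢ 1 (λ { r0 () ; r1 () ; r2 () ; r3 () ; r4 () }) n))
        (tri-5n+1 n))
  , (λ n → ⇔-trans
        (c3-odd⇔pent (5 * n + 2) (positive n 1) (tri-≢ 2 (λ { r0 () ; r1 () ; r2 () ; r3 () ; r4 () }) n))
        (pentℤ-5n+2 n))
  , (λ n → ⇔-trans
        (c3-odd⇔tri (5 * n + 3) (positive n 2) (pentℤ-≢ 3 (λ { r0 () ; r1 () ; r2 () ; r3 () ; r4 () }) n))
        (tri-5n+3 n))
  , (λ n → ⇔-trans
        (c3-odd⇔pent (5 * n + 4) (positive n 3) (tri-≢ 4 (λ { r0 () ; r1 () ; r2 () ; r3 () ; r4 () }) n))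
        (pentℤ-5n+4 n))
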